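{- Let $(Q_{n,k})$ be a regular B-representable family of polynomials with orthogonal companion $Q^{\perp}_{n,k}=A_{n,k}(Q_{1,1},\ldots,Q_{n-k+1,1})$. Then for all integers $n\ge k\ge0$: (i) $Q^{\perp}_{n,n-k}=(-1)^k\sum_{j=0}^k\binom{k+n}{k-j}\binom{k-n}{k+j}(Q^{\perp}_{1,1})^{n+j}Q_{k+j,j}$; (ii) $Q_{n,n-k}=(-1)^k\sum_{j=0}^k\binom{k+n}{k-j}\binom{k-n}{k+j}(Q_{1,1})^{n+j}Q^{\perp}_{k+j,j}$.
   Context: $\mathbb{K}$ is a field of characteristic zero; binomial coefficients $\binom mj$ with integer $m$ and $j\ge0$ are $m(m-1)\cdots(m-j+1)/j!$. Partial Bell polynomials: $B_{0,0}=1$, $B_{n,0}=0$ ($n\ge1$), $B_{n,k}=0$ ($k>n$), and for $1\le k\le n$, $B_{n,k}=\sum\frac{n!}{\prod_ir_i!(i!)^{r_i}}\prod_iX_i^{r_i}$ over non-negative integers with $\sum r_i=k$, $\sum ir_i=n$. $A_{n,k}\in\mathbb{K}[X_1^{ -1},X_1,X_2,\ldots]$ is the unique lower triangular family with $A_{0,0}=1$, $A_{n,0}=0$ ($n\ge1$) and $\sum_{j=k}^nA_{n,j}B_{j,k}=\delta_{nk}$. A family $(Q_{n,k})_{n,k\ge0}$ is B-representable if $Q_{n,k}=0$ for $k>n$, $Q_{0,0}=1$, $Q_{n,0}=0$ ($n\ge1$), and there exist polynomials $H_j$ with $Q_{n,k}=B_{n,k}(H_1,\ldots,H_{n-k+1})$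 for all $1\le k\le n$; it is regular if its finite lower triangular matrices are nonsingular. The same conventions for index $0$ hold for $Q^{\perp}$. -}

module Defs where

open import Level using (Level; _⊔_) renaming (suc to lsuc)
open import Data.Nat as ℕ using (ℕ; zero; suc; _≤_; _<_; _∸_)
open import Data.Nat using (_!)
open import Data.Nat.Properties using (_≟_; _!≢0)
open import Data.Integer as ℤ using (ℤ; +_; -[1+_]; _/ℕ_)
open import Data.Fin using (Fin; toℕ) renaming (zero to fzero; suc to fsuc)
open import Data.List using (List; []; _∷_; map; concatMap; foldr; upTo)
open import Data.Bool using (Bool; _∧_; if_then_else_)
open import Data.Product using (Σ; ∃; _×_; _,_)
open import Relation.Nullary using (¬_)
open import Relation.Nullary.Decidable using (⌊_⌋)
open import Algebra.Bundles using (CommutativeRing; Semiring)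
import Algebra.Definitions.RawSemiring as RSD

-- Binomial coefficient with integer upper index m and natural j:
-- binom m j = m (m-1) ... (m-j+1) / j!   (an exact integer division)

fallingℤ : ℤ → ℕ → ℤ
fallingℤ m zero    = + 1
fallingℤ m (suc j) = fallingℤ m j ℤ.* (m ℤ.- + j)

binomℤ : ℤ → ℕ → ℤ
binomℤ m j = (fallingℤ m j /ℕ (j !)) {{j !≢0}}

-- total division (the denominators used below are never zero anyway)
divℕ : ℕ → ℕ → ℕ
divℕ n zero    = 0
divℕ n (suc d) = n ℕ./ suc d

tuples : ℕ → ℕ → List (List ℕ)
tuples zero    b = [] ∷ []
tuples (suc l) b = concatMap (λ r → map (r ∷_) (tuples l b)) (upTo (suc b))

sumℕ : List ℕ → ℕ
sumℕ = foldr ℕ._+_ 0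

wsum : ℕ → List ℕ → ℕ
wsum i []       = 0
wsum i (r ∷ rs) = i ℕ.* r ℕ.+ wsum (suc i) rs

denom : ℕ → List ℕ → ℕ
denom i []       = 1
denom i (r ∷ rs) = (r ! ℕ.* ((i !) ℕ.^ r)) ℕ.* denom (suc i) rs

record CharZeroField (c ℓ : Level) : Set (lsuc (c ⊔ ℓ)) where
  field
    commRing : CommutativeRing c ℓ
  open CommutativeRing commRing public
  open RSD (Semiring.rawSemiring semiring) public using (_^_) renaming (_×_ to _·_)
  field
    inverse  : ∀ x → ¬ (x ≈ 0#) → ∃ λ y → x * y ≈ 1#
    charZero : ∀ n → ¬ (suc n · 1# ≈ 0#)

module FieldDefs {c ℓ} (F : CharZeroField c ℓ) where
  open CharZeroField F

  fromℤ : ℤ → Carrier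
  fromℤ (+ n)    = n · 1#
  fromℤ -[1+ n ] = - (suc n · 1#)

  sumL : List Carrier → Carrier
  sumL = foldr _+_ 0#

  -- Σ_{j=a}^{b} f j   (empty if b < a)
  sumRange : ℕ → ℕ → (ℕ → Carrier) → Carrier
  sumRange a b f = sumL (map (λ t → f (a ℕ.+ t)) (upTo (suc b ∸ a)))

  sumFin : ∀ {N} → (Fin N → Carrier) → Carrier
  sumFin {zero}  f = 0#
  sumFin {suc N} f = f fzero + sumFin (λ i → f (fsuc i))

  δ : ℕ → ℕ → Carrier
  δ n k = if ⌊ n ≟ k ⌋ then 1# else 0#

  monomial : (ℕ → Carrier) → ℕ → List ℕ → Carrier
  monomial x i []       = 1#
  monomial x i (r ∷ rs) = (x i ^ r) * monomial x (suc i) rs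

  -- Partial Bell polynomial B_{n,k} evaluated at X_i := x i (i ≥ 1):
  -- Σ over (r_1,…,r_n) ∈ ℕⁿ with Σ r_i = k, Σ i r_i = n of
  --   n! / ∏ r_i! (i!)^{r_i} · ∏ X_i^{r_i}.
  -- (Any r_i > n is excluded by Σ i r_i = n, so entries ≤ n suffice.)
  -- This formula also yields B_{0,0} = 1, B_{n,0} = 0 (n ≥ 1),
  -- B_{n,k} = 0 (k > n), but we impose these conventions explicitly.
  bellFormula : ℕ → ℕ → (ℕ → Carrier) → Carrier
  bellFormula n k x = sumL (map term (tuples n n))
    where
    term : List ℕ → Carrier
    term r = if ⌊ sumℕ r ≟ k ⌋ ∧ ⌊ wsum 1 r ≟ n ⌋
             then divℕ (n !) (denom 1 r) · monomial x 1 r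
             else 0#

  Bell : ℕ → ℕ → (ℕ → Carrier) → Carrier
  Bell zero    zero    x = 1#
  Bell (suc n) zero    x = 0#
  Bell n       (suc k) x = bellFormula n (suc k) x

  Family : Set c
  Family = ℕ → ℕ → Carrier

  Conventions : Family → Set ℓ
  Conventions Q = (∀ n k → n < k → Q n k ≈ 0#)
                × (Q 0 0 ≈ 1#)
                × (∀ n → Q (suc n) 0 ≈ 0#)

  BRepresentable : Family → Set (c ⊔ ℓ)
  BRepresentable Q = Conventions Q
    × ∃ λ (H : ℕ → Carrier) → ∀ n k → 1 ≤ k → k ≤ n → Q n k ≈ Bell n k H

  Matrix : ℕ → Set c
  Matrix N = Fin N → Fin N → Carrier

  infixl 7 _⊗_
  infix 4 _≈M_
  _⊗_ : ∀ {N} → Matrix N → Matrix N → Matrix N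
  (M ⊗ M′) i j = sumFin (λ t → M i t * M′ t j)

  identity : ∀ {N} → Matrix N
  identity i j = δ (toℕ i) (toℕ j)

  _≈M_ : ∀ {N} → Matrix N → Matrix N → Set ℓ
  M ≈M M′ = ∀ i j → M i j ≈ M′ i j

  Nonsingular : ∀ {N} → Matrix N → Set (c ⊔ ℓ)
  Nonsingular M = ∃ λ M′ → (M ⊗ M′ ≈M identity) × (M′ ⊗ M ≈M identity)

  truncation : Family → (N : ℕ) → Matrix (suc N)
  truncation Q N i j = Q (toℕ i) (toℕ j)

  Regular : Family → Set (c ⊔ ℓ)
  Regular Q = ∀ N → Nonsingular (truncation Q N)

  -- P is the family A_{n,k} evaluated at X_i := x i: it satisfies the
  -- defining properties of A (index conventions and
  -- Σ_{j=k}^{n} A_{n,j} B_{j,k} = δ_{nk}) with X_i replaced by x i.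
  IsAEvaluatedAt : (ℕ → Carrier) → Family → Set ℓ
  IsAEvaluatedAt x P = Conventions P
    × (∀ n k → k ≤ n → sumRange k n (λ j → P n j * Bell j k x) ≈ δ n k)

{-# OPTIONS --safe #-}
module Submission where

-- Let f = Σ Q_{i,1} tⁱ/i!, let h = Q_{1,1} and a = 1/h = Q⊥_{1,1}, and put p_k(x) = [tᵏ] (a f / t)ˣ.
-- The multinomial theorem gives Q_{k+j,j} = (k+j)!/j! · hʲ p_k(j).  Solving the differential
-- equation of (a f / t)ˣ shows that p_k is a polynomial of degree ≤ k in x, divisible by x if
-- k ≥ 1; hence r_k(x) = x/(x+k) · p_k(-k-x) is one too.  Lagrange inversion is the statement
-- Q⊥_{k+j,j} = (k+j)!/j! · a^{k+j} r_k(j); it follows since this family is a left inverse of Q.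
-- For every polynomial g of degree ≤ k, interpolation at 0, 1, …, k reads
--   Σ_j binom(k-y, k-j) binom(y, j) g(j) = g(y),
-- and (i), (ii) are this identity at y = -n for g = p_k and g = r_k, because
-- x r_k(-k-x) = (x+k) p_k(x).

open import Defs
open import Level using (_⊔_)
open import Algebra.Bundles using (CommutativeRing)
import Algebra.Properties.CommutativeSemiring.Exp as Exponentiation
import Algebra.Properties.Ring as RingProperties
import Algebra.Properties.Semiring.Mult as SemiringMult
import Algebra.Solver.Ring
open import Algebra.Solver.Ring.AlmostCommutativeRing using (_-Raw-AlmostCommutative⟶_; fromCommutativeRing)
import Algebra.Solver.Ring.NaturalCoefficients.Default as SemiringSolver
open import Data.Bool using (_∧_; if_then_else_)
open import Data.Integer as ℤ using (ℤ; +_; -[1+_]; _⊖_)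
import Data.Integer.DivMod as ℤDivMod
import Data.Integer.Properties as ℤₚ
import Data.Integer.Tactic.RingSolver as ℤRing
open import Data.List using (List; []; _∷_; _++_; concatMap; applyUpTo) renaming (map to mapL)
open import Data.List.Properties using (map-upTo)
open import Data.Maybe using (Maybe; map)
open import Data.Nat as ℕ using (ℕ; zero; suc; _≤_; _<_; z≤n; s≤s; _∸_; _!)
open import Data.Nat.Combinatorics using (k![n∸k]!∣n!)
open import Data.Nat.DivMod using (m/n*n≡m)
open import Data.Nat.Divisibility using (_∣_; ∣-refl; ∣-trans; *-pres-∣; 0∣⇒≡0; *-monoʳ-∣; 1∣_)
import Data.Nat.Properties as ℕₚ
open import Data.Nat.Tactic.RingSolver using (solve-∀)
open import Data.Product using (_×_; _,_; proj₁; proj₂; ∃)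
open import Function using (_∘_; id)
open import Relation.Binary.Consequences using (dec⇒weaklyDec)
open import Relation.Binary.PropositionalEquality as ≡ using (_≡_; _≢_)
import Relation.Binary.Reasoning.Setoid as SetoidReasoning
open import Relation.Nullary using (yes; no; contradiction)
open import Relation.Nullary.Decidable using (⌊_⌋)

-- The families are known only at natural arguments j, whereas the sums have to be evaluated at -n.
-- For this reason the exponent of `p` is an arbitrary field element: a power defined by its
-- differential equation has coefficients that are polynomial in the exponent, so values at natural
-- numbers determine the value at -n.
--
-- The second obstacle is division by zero. Put m = n - k. The quotient x/(x + k) is meaningless at
-- x = -k, a value that -n takes exactly when m = 0, and m = 0 is allowed. So x is divided out of
-- p_k once and for all, in `σ`, and the closed form of the prefactor that the binomials leave keeps
-- n and m as factors instead of dividing by them.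
--
-- Finally, the definitions divide inside ℕ and ℤ. Two integrality arguments about factorials are
-- needed before their values can be treated as fractions in the field.

module Sums {c ℓ} (R : CommutativeRing c ℓ) where
  open CommutativeRing R
  open SetoidReasoning setoid
  open SemiringSolver commutativeSemiring using (solve; _:+_; _:=_)

  Σ< : ℕ → (ℕ → Carrier) → Carrier
  Σ< zero    f = 0#
  Σ< (suc n) f = f 0 + Σ< n (f ∘ suc)

  Σ<-cong : ∀ n {f g} → (∀ i → i < n → f i ≈ g i) → Σ< n f ≈ Σ< n g
  Σ<-cong zero    e = refl
  Σ<-cong (suc n) e = +-cong (e 0 (s≤s z≤n)) (Σ<-cong n (λ i i<n → e (suc i) (s≤s i<n)))

  Σ<-zero : ∀ n {f} → (∀ i → i < n → f i ≈ 0#) → Σ< n f ≈ 0#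
  Σ<-zero zero    e = refl
  Σ<-zero (suc n) e =
    trans (+-cong (e 0 (s≤s z≤n)) (Σ<-zero n (λ i i<n → e (suc i) (s≤s i<n)))) (+-identityˡ 0#)

  Σ<-+ : ∀ n f g → Σ< n (λ i → f i + g i) ≈ Σ< n f + Σ< n g
  Σ<-+ zero    f g = sym (+-identityˡ 0#)
  Σ<-+ (suc n) f g = begin
    (f 0 + g 0) + Σ< n (λ i → f (suc i) + g (suc i))
      ≈⟨ +-congˡ (Σ<-+ n (f ∘ suc) (g ∘ suc)) ⟩
    (f 0 + g 0) + (Σ< n (f ∘ suc) + Σ< n (g ∘ suc))
      ≈⟨ solve 4 (λ a b c d → (a :+ b) :+ (c :+ d) := (a :+ c) :+ (b :+ d)) refl _ _ _ _ ⟩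
    (f 0 + Σ< n (f ∘ suc)) + (g 0 + Σ< n (g ∘ suc)) ∎

  Σ<-*ˡ : ∀ n x f → Σ< n (λ i → x * f i) ≈ x * Σ< n f
  Σ<-*ˡ zero    x f = sym (zeroʳ x)
  Σ<-*ˡ (suc n) x f = trans (+-congˡ (Σ<-*ˡ n x (f ∘ suc))) (sym (distribˡ x _ _))

  Σ<-truncate : ∀ {m n} f → m ≤ n → (∀ i → m ≤ i → f i ≈ 0#) → Σ< n f ≈ Σ< m f
  Σ<-truncate {zero}  {n}     f m≤n       e = Σ<-zero n (λ i _ → e i z≤n)
  Σ<-truncate {suc m} {suc n} f (s≤s m≤n) e =
    +-congˡ (Σ<-truncate (f ∘ suc) m≤n (λ i m≤i → e (suc i) (s≤s m≤i)))

-- Formal power series: ring structure and derivations.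

module PowerSeries {c ℓ} (R : CommutativeRing c ℓ) where
  open CommutativeRing R
  open Sums R
  open SetoidReasoning setoid
  open SemiringMult semiring using (×-comm-*) renaming (_×_ to _·_)
  open SemiringSolver commutativeSemiring using (solve; _:+_; _:*_; _:=_)

  Series : Set c
  Series = ℕ → Carrier

  infix 4 _≋_
  _≋_ : Series → Series → Set ℓ
  U ≋ V = ∀ n → U n ≈ V n

  tail : Series → Series
  tail U n = U (suc n)

  infixl 6 _⊕_
  infixl 7 _⊛_ _◂_

  -- The Cauchy product by recursion on the degree, splitting off the constant term of the left
  -- factor. The ring laws become inductions in which `tail U` replaces `U`; `⊛-Σ` returns to the
  -- convolution sum.
  _⊕_ _⊛_ : Series → Series → Series
  (U ⊕ V) n = U n + V n
  (U ⊛ V) zero    = U 0 * V 0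
  (U ⊛ V) (suc n) = U 0 * V (suc n) + (tail U ⊛ V) n

  _◂_ : Carrier → Series → Series
  (x ◂ U) n = x * U n

  𝟘 𝟙 : Series
  𝟘 _ = 0#
  𝟙 zero    = 1#
  𝟙 (suc _) = 0#

  -- Stated up to a degree because recursively defined series can be compared only on the
  -- coefficients already treated.
  ⊛-cong-≤ : ∀ n {U U′ V V′} → (∀ i → i ≤ n → U i ≈ U′ i) → (∀ i → i ≤ n → V i ≈ V′ i) →
             (U ⊛ V) n ≈ (U′ ⊛ V′) n
  ⊛-cong-≤ zero    e d = *-cong (e 0 z≤n) (d 0 z≤n)
  ⊛-cong-≤ (suc n) e d = +-cong (*-cong (e 0 z≤n) (d (suc n) ℕₚ.≤-refl))
    (⊛-cong-≤ n (λ i i≤n → e (suc i) (s≤s i≤n)) (λ i i≤n → d i (ℕₚ.m≤n⇒m≤1+n i≤n)))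

  ⊛-cong : ∀ {U U′ V V′} → U ≋ U′ → V ≋ V′ → U ⊛ V ≋ U′ ⊛ V′
  ⊛-cong e d n = ⊛-cong-≤ n (λ i _ → e i) (λ i _ → d i)

  ⊛-Σ : ∀ U V n → (U ⊛ V) n ≈ Σ< (suc n) (λ i → U i * V (n ∸ i))
  ⊛-Σ U V zero    = sym (+-identityʳ _)
  ⊛-Σ U V (suc n) = +-congˡ (⊛-Σ (tail U) V n)

  ⊛-distribʳ : ∀ W U V → (U ⊕ V) ⊛ W ≋ (U ⊛ W) ⊕ (V ⊛ W)
  ⊛-distribʳ W U V zero    = distribʳ _ _ _
  ⊛-distribʳ W U V (suc n) = begin
    (U 0 + V 0) * W (suc n) + ((tail U ⊕ tail V) ⊛ W) n
      ≈⟨ +-congˡ (⊛-distribʳ W (tail U) (tail V) n) ⟩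
    (U 0 + V 0) * W (suc n) + ((tail U ⊛ W) n + (tail V ⊛ W) n)
      ≈⟨ solve 5 (λ u v w x y → (u :+ v) :* w :+ (x :+ y) := (u :* w :+ x) :+ (v :* w :+ y))
           refl _ _ _ _ _ ⟩
    (U ⊛ W) (suc n) + (V ⊛ W) (suc n) ∎

  ◂-⊛ : ∀ x U V → (x ◂ U) ⊛ V ≋ x ◂ (U ⊛ V)
  ◂-⊛ x U V zero    = *-assoc _ _ _
  ◂-⊛ x U V (suc n) = trans (+-cong (*-assoc _ _ _) (◂-⊛ x (tail U) V n)) (sym (distribˡ _ _ _))

  𝟘-⊛ : ∀ U V → U ≋ 𝟘 → U ⊛ V ≋ 𝟘
  𝟘-⊛ U V e zero    = trans (*-congʳ (e 0)) (zeroˡ _)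
  𝟘-⊛ U V e (suc n) =
    trans (+-cong (trans (*-congʳ (e 0)) (zeroˡ _)) (𝟘-⊛ (tail U) V (λ i → e (suc i)) n)) (+-identityˡ 0#)

  ⊛-identityˡ : ∀ U → 𝟙 ⊛ U ≋ U
  ⊛-identityˡ U zero    = *-identityˡ _
  ⊛-identityˡ U (suc n) =
    trans (+-cong (*-identityˡ _) (𝟘-⊛ (tail 𝟙) U (λ _ → refl) n)) (+-identityʳ _)

  -- Mirror image of the defining clause, peeling the right factor instead of the left one;
  -- commutativity is the induction that passes between the two.
  ⊛-tailʳ : ∀ U V n → (U ⊛ V) (suc n) ≈ (U ⊛ tail V) n + U (suc n) * V 0
  ⊛-tailʳ U V zero    = refl
  ⊛-tailʳ U V (suc n) = trans (+-congˡ (⊛-tailʳ (tail U) V n)) (sym (+-assoc _ _ _))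

  ⊛-comm : ∀ U V → U ⊛ V ≋ V ⊛ U
  ⊛-comm U V zero    = *-comm _ _
  ⊛-comm U V (suc n) = begin
    U 0 * V (suc n) + (tail U ⊛ V) n ≈⟨ +-cong (*-comm _ _) (⊛-comm (tail U) V n) ⟩
    V (suc n) * U 0 + (V ⊛ tail U) n ≈⟨ +-comm _ _ ⟩
    (V ⊛ tail U) n + V (suc n) * U 0 ≈⟨ ⊛-tailʳ V U n ⟨
    (V ⊛ U) (suc n) ∎

  ⊛-assoc : ∀ U V W → (U ⊛ V) ⊛ W ≋ U ⊛ (V ⊛ W)
  ⊛-assoc U V W zero    = *-assoc _ _ _
  ⊛-assoc U V W (suc n) = begin
    (U 0 * V 0) * W (suc n) + (((U 0 ◂ tail V) ⊕ (tail U ⊛ V)) ⊛ W) n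
      ≈⟨ +-congˡ (⊛-distribʳ W (U 0 ◂ tail V) (tail U ⊛ V) n) ⟩
    (U 0 * V 0) * W (suc n) + (((U 0 ◂ tail V) ⊛ W) n + ((tail U ⊛ V) ⊛ W) n)
      ≈⟨ +-congˡ (+-cong (◂-⊛ (U 0) (tail V) W n) (⊛-assoc (tail U) V W n)) ⟩
    (U 0 * V 0) * W (suc n) + (U 0 * (tail V ⊛ W) n + (tail U ⊛ (V ⊛ W)) n)
      ≈⟨ solve 5 (λ u v w x y → (u :* v) :* w :+ (u :* x :+ y) := u :* (v :* w :+ x) :+ y)
           refl _ _ _ _ _ ⟩
    U 0 * (V 0 * W (suc n) + (tail V ⊛ W) n) + (tail U ⊛ (V ⊛ W)) n ∎

  -- Packaged as a ring so that the construction can be applied to itself: series in u over series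
  -- in t carry the generating function of the Bell polynomials. Powers of series then come from
  -- generic exponentiation.
  seriesRing : CommutativeRing c ℓ
  seriesRing = record
    { Carrier = Series
    ; _≈_ = _≋_
    ; _+_ = _⊕_
    ; _*_ = _⊛_
    ; -_ = λ U n → - U n
    ; 0# = 𝟘
    ; 1# = 𝟙
    ; isCommutativeRing = record
      { isRing = record
        { +-isAbelianGroup = record
          { isGroup = record
            { isMonoid = record
              { isSemigroup = record
                { isMagma = record
                  { isEquivalence = record
                    { refl = λ _ → refl ; sym = λ e n → sym (e n) ; trans = λ e d n → trans (e n) (d n) }
                  ; ∙-cong = λ e d n → +-cong (e n) (d n)
                  }
                ; assoc = λ U V W n → +-assoc _ _ _
                }
              ; identity = (λ U n → +-identityˡ _) , (λ U n → +-identityʳ _)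
              }
            ; inverse = (λ U n → -‿inverseˡ _) , (λ U n → -‿inverseʳ _)
            ; ⁻¹-cong = λ e n → -‿cong (e n)
            }
          ; comm = λ U V n → +-comm _ _
          }
        ; *-cong = ⊛-cong
        ; *-assoc = ⊛-assoc
        ; *-identity = ⊛-identityˡ , (λ U n → trans (⊛-comm U 𝟙 n) (⊛-identityˡ U n))
        ; distrib = (λ W U V n → trans (⊛-comm W (U ⊕ V) n)
                       (trans (⊛-distribʳ W U V n) (+-cong (⊛-comm U W n) (⊛-comm V W n))))
                  , ⊛-distribʳ
        }
      ; *-comm = ⊛-comm
      }
    }

  ⊛-◂ : ∀ x U V → U ⊛ (x ◂ V) ≋ x ◂ (U ⊛ V)
  ⊛-◂ x U V n = trans (⊛-comm U (x ◂ V) n) (trans (◂-⊛ x V U n) (*-congˡ (⊛-comm V U n)))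

  -- `θ` is t d/dt and `∂` is d/dt. The product rule is proved for `θ`, where the weight n splits
  -- along the convolution; `∂` inherits it, being `θ` read one degree higher.
  θ ∂ : Series → Series
  θ U n = n · U n
  ∂ U n = suc n · U (suc n)

  θ-⊛ : ∀ U V → θ (U ⊛ V) ≋ (θ U ⊛ V) ⊕ (U ⊛ θ V)
  θ-⊛ U V zero    = sym (trans (+-cong (zeroˡ _) (zeroʳ _)) (+-identityˡ 0#))
  θ-⊛ U V (suc n) = begin
    suc n · (U 0 * V (suc n) + (tail U ⊛ V) n)
      ≈⟨ ·-distrib (suc n) _ _ ⟩
    suc n · (U 0 * V (suc n)) + ((tail U ⊛ V) n + n · (tail U ⊛ V) n)
      ≈⟨ +-cong (sym (×-comm-* (suc n) _ _)) (+-congˡ (θ-⊛ (tail U) V n)) ⟩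
    U 0 * (suc n · V (suc n)) + ((tail U ⊛ V) n + ((θ (tail U) ⊛ V) n + (tail U ⊛ θ V) n))
      ≈⟨ solve 4 (λ a b c d → a :+ (b :+ (c :+ d)) := (b :+ c) :+ (a :+ d)) refl _ _ _ _ ⟩
    ((tail U ⊛ V) n + (θ (tail U) ⊛ V) n) + (U ⊛ θ V) (suc n)
      -- By computation `tail (θ U)` is `tail U ⊕ θ (tail U)`, because suc n = 1 + n.
      ≈⟨ +-congʳ (⊛-distribʳ V (tail U) (θ (tail U)) n) ⟨
    ((tail (θ U)) ⊛ V) n + (U ⊛ θ V) (suc n)
      ≈⟨ +-congʳ (trans (+-congʳ (zeroˡ _)) (+-identityˡ _)) ⟨
    (θ U ⊛ V) (suc n) + (U ⊛ θ V) (suc n) ∎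
    where
    ·-distrib : ∀ n x y → n · (x + y) ≈ n · x + n · y
    ·-distrib zero    x y = sym (+-identityˡ 0#)
    ·-distrib (suc n) x y = trans (+-congˡ (·-distrib n x y))
      (solve 4 (λ a b c d → (a :+ b) :+ (c :+ d) := (a :+ c) :+ (b :+ d)) refl _ _ _ _)

  ∂-⊛ : ∀ U V → ∂ (U ⊛ V) ≋ (∂ U ⊛ V) ⊕ (U ⊛ ∂ V)
  ∂-⊛ U V n = begin
    ∂ (U ⊛ V) n ≈⟨ θ-⊛ U V (suc n) ⟩
    (0# * V (suc n) + (∂ U ⊛ V) n) + (U ⊛ θ V) (suc n)
      ≈⟨ +-cong (trans (+-congʳ (zeroˡ _)) (+-identityˡ _))
           (trans (⊛-tailʳ U (θ V) n) (trans (+-congˡ (zeroʳ _)) (+-identityʳ _))) ⟩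
    (∂ U ⊛ V) n + (U ⊛ ∂ V) n ∎

  module ≋ = CommutativeRing seriesRing

-- Integers in the field, binomial coefficients, polynomial functions and interpolation.

module Scalars {c ℓ} (F : CharZeroField c ℓ) where
  open CharZeroField F
  open FieldDefs F using (fromℤ)
  open SetoidReasoning setoid
  open SemiringMult semiring using (×-homo-+; ×1-homo-*; ×-assoc-*; ×-congʳ)
  open RingProperties ring using (-0#≈0#; -‿involutive; -‿distribˡ-*; -‿distribʳ-*; -‿+-comm)

  ι : ℕ → Carrier
  ι n = n · 1#

  fromℤ-⊖ : ∀ m n → fromℤ (m ⊖ n) ≈ ι m - ι n
  fromℤ-⊖ m       zero    = sym (trans (+-congˡ -0#≈0#) (+-identityʳ _))
  fromℤ-⊖ zero    (suc n) = sym (+-identityˡ _)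
  fromℤ-⊖ (suc m) (suc n) = begin
    fromℤ (suc m ⊖ suc n)             ≡⟨ ≡.cong fromℤ (ℤₚ.[1+m]⊖[1+n]≡m⊖n m n) ⟩
    fromℤ (m ⊖ n)                     ≈⟨ fromℤ-⊖ m n ⟩
    ι m - ι n                         ≈⟨ +-congʳ (+-identityʳ _) ⟨
    ι m + 0# - ι n                    ≈⟨ +-congʳ (+-congˡ (-‿inverseʳ 1#)) ⟨
    ι m + (1# - 1#) - ι n             ≈⟨ +-congʳ (trans (sym (+-assoc _ _ _)) (+-congʳ (+-comm _ _))) ⟩
    1# + ι m - 1# - ι n               ≈⟨ +-assoc _ _ _ ⟩
    1# + ι m + (- 1# - ι n)           ≈⟨ +-congˡ (-‿+-comm _ _) ⟩
    1# + ι m - (1# + ι n)             ∎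

  fromℤ-neg : ∀ x → fromℤ (ℤ.- x) ≈ - fromℤ x
  fromℤ-neg (+ zero)  = sym -0#≈0#
  fromℤ-neg (+ suc n) = refl
  fromℤ-neg -[1+ n ]  = sym (-‿involutive _)

  fromℤ-+ : ∀ x y → fromℤ (x ℤ.+ y) ≈ fromℤ x + fromℤ y
  fromℤ-+ (+ m)    (+ n)    = ×-homo-+ 1# m n
  fromℤ-+ (+ m)    -[1+ n ] = fromℤ-⊖ m (suc n)
  fromℤ-+ -[1+ m ] (+ n)    = trans (fromℤ-⊖ n (suc m)) (+-comm _ _)
  fromℤ-+ -[1+ m ] -[1+ n ] = begin
    - ι (suc (suc (m ℕ.+ n)))  ≡⟨ ≡.cong (λ i → - ι (suc i)) (ℕₚ.+-suc m n) ⟨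
    - ι (suc m ℕ.+ suc n)      ≈⟨ -‿cong (×-homo-+ 1# (suc m) (suc n)) ⟩
    - (ι (suc m) + ι (suc n))  ≈⟨ -‿+-comm _ _ ⟨
    - ι (suc m) - ι (suc n)    ∎

  fromℤ-+* : ∀ m y → fromℤ (+ m ℤ.* y) ≈ ι m * fromℤ y
  fromℤ-+* m (+ n)    = trans (reflexive (≡.cong fromℤ (≡.sym (ℤₚ.pos-* m n)))) (×1-homo-* m n)
  fromℤ-+* m -[1+ n ] = begin
    fromℤ (+ m ℤ.* -[1+ n ])            ≡⟨ ≡.cong fromℤ (ℤₚ.neg-distribʳ-* (+ m) (+ suc n)) ⟨
    fromℤ (ℤ.- (+ m ℤ.* + suc n))       ≈⟨ fromℤ-neg (+ m ℤ.* + suc n) ⟩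
    - fromℤ (+ m ℤ.* + suc n)           ≈⟨ -‿cong (fromℤ-+* m (+ suc n)) ⟩
    - (ι m * ι (suc n))                 ≈⟨ -‿distribʳ-* _ _ ⟩
    ι m * - ι (suc n)                   ∎

  fromℤ-* : ∀ x y → fromℤ (x ℤ.* y) ≈ fromℤ x * fromℤ y
  fromℤ-* (+ m)    y = fromℤ-+* m y
  fromℤ-* -[1+ m ] y = begin
    fromℤ (-[1+ m ] ℤ.* y)              ≡⟨ ≡.cong fromℤ (ℤₚ.neg-distribˡ-* (+ suc m) y) ⟨
    fromℤ (ℤ.- (+ suc m ℤ.* y))         ≈⟨ fromℤ-neg (+ suc m ℤ.* y) ⟩
    - fromℤ (+ suc m ℤ.* y)             ≈⟨ -‿cong (fromℤ-+* (suc m) y) ⟩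
    - (ι (suc m) * fromℤ y)             ≈⟨ -‿distribˡ-* _ _ ⟩
    - ι (suc m) * fromℤ y               ∎

  -- The constants of the ring solver have to denote 1# and - 1#, whereas fromℤ (+ 1) is 1# + 0#.
  literal : ℤ → Carrier
  literal (+ 1)      = 1#
  literal -[1+ 0 ]   = - 1#
  literal x          = fromℤ x

  literal≈fromℤ : ∀ x → literal x ≈ fromℤ x
  literal≈fromℤ (+ 0)           = refl
  literal≈fromℤ (+ 1)           = sym (+-identityʳ 1#)
  literal≈fromℤ (+ suc (suc n)) = refl
  literal≈fromℤ -[1+ 0 ]        = -‿cong (sym (+-identityʳ 1#))
  literal≈fromℤ -[1+ suc n ]    = refl

  literal-morphism : ℤ.+-*-rawRing -Raw-AlmostCommutative⟶ fromCommutativeRing commRing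
  literal-morphism = record
    { ⟦_⟧    = literal
    ; +-homo = λ x y → trans (literal≈fromℤ (x ℤ.+ y)) (trans (fromℤ-+ x y)
                 (sym (+-cong (literal≈fromℤ x) (literal≈fromℤ y))))
    ; *-homo = λ x y → trans (literal≈fromℤ (x ℤ.* y)) (trans (fromℤ-* x y)
                 (sym (*-cong (literal≈fromℤ x) (literal≈fromℤ y))))
    ; -‿homo = λ x → trans (literal≈fromℤ (ℤ.- x)) (trans (fromℤ-neg x) (sym (-‿cong (literal≈fromℤ x))))
    ; 0-homo = refl
    ; 1-homo = refl
    }

  literal-≟ : ∀ m n → Maybe (literal m ≈ literal n)
  literal-≟ m n = map (λ { ≡.refl → refl }) (dec⇒weaklyDec ℤ._≟_ m n)

  module ℤ-Solver = Algebra.Solver.Ring ℤ.+-*-rawRing (fromCommutativeRing commRing) literal-morphism literal-≟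

  ·-ι : ∀ n x → n · x ≈ ι n * x
  ·-ι n x = sym (trans (×-assoc-* n 1# x) (×-congʳ n (*-identityˡ x)))

  ι⁻¹ : ℕ → Carrier
  ι⁻¹ n = proj₁ (inverse (ι (suc n)) (charZero n))

  ι⁻¹-inverse : ∀ n → ι (suc n) * ι⁻¹ n ≈ 1#
  ι⁻¹-inverse n = proj₂ (inverse (ι (suc n)) (charZero n))

  ι-cancel : ∀ n {x y} → ι (suc n) * x ≈ ι (suc n) * y → x ≈ y
  ι-cancel n {x} {y} e = begin
    x                            ≈⟨ lemma x ⟨
    ι⁻¹ n * (ι (suc n) * x)      ≈⟨ *-congˡ e ⟩
    ι⁻¹ n * (ι (suc n) * y)      ≈⟨ lemma y ⟩
    y                            ∎
    where
    lemma : ∀ z → ι⁻¹ n * (ι (suc n) * z) ≈ z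
    lemma z = trans (sym (*-assoc _ _ _))
      (trans (*-congʳ (trans (*-comm _ _) (ι⁻¹-inverse n))) (*-identityˡ z))

  -- This is 1/n!, built from the inverses that characteristic zero provides.
  φ : ℕ → Carrier
  φ zero    = 1#
  φ (suc n) = φ n * ι⁻¹ n

  φ-suc : ∀ n → ι (suc n) * φ (suc n) ≈ φ n
  φ-suc n = begin
    ι (suc n) * (φ n * ι⁻¹ n)   ≈⟨ solve 3 (λ i p j → i :* (p :* j) := p :* (i :* j)) refl _ _ _ ⟩
    φ n * (ι (suc n) * ι⁻¹ n)   ≈⟨ *-congˡ (ι⁻¹-inverse n) ⟩
    φ n * 1#                    ≈⟨ *-identityʳ _ ⟩
    φ n                         ∎
    where open ℤ-Solver

  !-φ : ∀ n → ι (n !) * φ n ≈ 1#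
  !-φ zero    = trans (*-identityʳ _) (+-identityʳ 1#)
  !-φ (suc n) = begin
    ι (suc n ℕ.* n !) * φ (suc n)       ≈⟨ *-congʳ (×1-homo-* (suc n) (n !)) ⟩
    ι (suc n) * ι (n !) * φ (suc n)     ≈⟨ solve 3 (λ a b p → a :* b :* p := b :* (a :* p)) refl _ _ _ ⟩
    ι (n !) * (ι (suc n) * φ (suc n))   ≈⟨ *-congˡ (φ-suc n) ⟩
    ι (n !) * φ n                       ≈⟨ !-φ n ⟩
    1#                                  ∎
    where open ℤ-Solver

  fall : Carrier → ℕ → Carrier
  fall x zero    = 1#
  fall x (suc j) = fall x j * (x - ι j)

  fall-cong : ∀ j {x y} → x ≈ y → fall x j ≈ fall y j
  fall-cong zero    e = refl
  fall-cong (suc j) e = *-cong (fall-cong j e) (+-congʳ e)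

  fall-absorb : ∀ x j → fall x (suc j) ≈ x * fall (x - 1#) j
  fall-absorb x zero    = solve 1 (λ x → con (+ 1) :* (x :- con (+ 0)) := x :* con (+ 1)) refl x
    where open ℤ-Solver
  fall-absorb x (suc j) = begin
    fall x (suc j) * (x - (1# + ι j))          ≈⟨ *-congʳ (fall-absorb x j) ⟩
    x * fall (x - 1#) j * (x - (1# + ι j))
      ≈⟨ solve 4 (λ x f o i → x :* f :* (x :- (o :+ i)) := x :* (f :* (x :- o :- i))) refl _ _ _ _ ⟩
    x * fall (x - 1#) (suc j)                  ∎
    where open ℤ-Solver

  fall-+ : ∀ x i j → fall x (i ℕ.+ j) ≈ fall x i * fall (x - ι i) j
  fall-+ x i zero    = trans (reflexive (≡.cong (fall x) (ℕₚ.+-identityʳ i))) (sym (*-identityʳ _))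
  fall-+ x i (suc j) = begin
    fall x (i ℕ.+ suc j)                              ≡⟨ ≡.cong (fall x) (ℕₚ.+-suc i j) ⟩
    fall x (i ℕ.+ j) * (x - ι (i ℕ.+ j))              ≈⟨ *-cong (fall-+ x i j) (+-congˡ (-‿cong (×-homo-+ 1# i j))) ⟩
    fall x i * fall (x - ι i) j * (x - (ι i + ι j))
      ≈⟨ solve 5 (λ a b x i j → a :* b :* (x :- (i :+ j)) := a :* (b :* (x :- i :- j))) refl _ _ _ _ _ ⟩
    fall x i * fall (x - ι i) (suc j)                 ∎
    where open ℤ-Solver

  fall-diagonal : ∀ n → fall (ι n) n ≈ ι (n !)
  fall-diagonal zero    = sym (+-identityʳ 1#)
  fall-diagonal (suc n) = begin
    fall (ι (suc n)) (suc n)           ≈⟨ fall-absorb _ n ⟩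
    ι (suc n) * fall (1# + ι n - 1#) n ≈⟨ *-congˡ (fall-cong n (solve 2 (λ o i → o :+ i :- o := i) refl _ _)) ⟩
    ι (suc n) * fall (ι n) n           ≈⟨ *-congˡ (fall-diagonal n) ⟩
    ι (suc n) * ι (n !)                ≈⟨ ×1-homo-* (suc n) (n !) ⟨
    ι (suc n !)                        ∎
    where open ℤ-Solver

  -- The binomial coefficient with a field element on top; as a series in j, `β x` is (1 + t)^x.
  β : Carrier → ℕ → Carrier
  β x j = fall x j * φ j

  β-cong : ∀ j {x y} → x ≈ y → β x j ≈ β y j
  β-cong j e = *-congʳ (fall-cong j e)

  β-suc : ∀ x j → ι (suc j) * β x (suc j) ≈ (x - ι j) * β x j
  β-suc x j = begin
    ι (suc j) * (fall x j * (x - ι j) * φ (suc j))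
      ≈⟨ solve 4 (λ a b c d → a :* (b :* c :* d) := c :* (b :* (a :* d))) refl _ _ _ _ ⟩
    (x - ι j) * (fall x j * (ι (suc j) * φ (suc j)))
      ≈⟨ *-congˡ (*-congˡ (φ-suc j)) ⟩
    (x - ι j) * β x j ∎
    where open ℤ-Solver

  β-absorb : ∀ x j → ι (suc j) * β x (suc j) ≈ x * β (x - 1#) j
  β-absorb x j = begin
    ι (suc j) * (fall x (suc j) * φ (suc j))
      ≈⟨ *-congˡ (*-congʳ (fall-absorb x j)) ⟩
    ι (suc j) * (x * fall (x - 1#) j * φ (suc j))
      ≈⟨ solve 4 (λ a b c d → a :* (b :* c :* d) := b :* (c :* (a :* d))) refl _ _ _ _ ⟩
    x * (fall (x - 1#) j * (ι (suc j) * φ (suc j)))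
      ≈⟨ *-congˡ (*-congˡ (φ-suc j)) ⟩
    x * β (x - 1#) j ∎
    where open ℤ-Solver

  β-diagonal : ∀ n → β (ι n) n ≈ 1#
  β-diagonal n = trans (*-congʳ (fall-diagonal n)) (!-φ n)

  open PowerSeries commRing
  open Sums commRing

  -- The differential equation (1 + t) U' = x U of U = (1 + t)^x, the term t U' being `θ`. With the
  -- constant term 1 it determines U, since each n + 1 is invertible.
  β-equation : ∀ x → ∂ (β x) ⊕ θ (β x) ≋ x ◂ β x
  β-equation x n = begin
    suc n · β x (suc n) + n · β x n            ≈⟨ +-cong (trans (·-ι (suc n) _) (β-suc x n)) (·-ι n _) ⟩
    (x - ι n) * β x n + ι n * β x n            ≈⟨ solve 3 (λ x n b → (x :- n) :* b :+ n :* b := x :* b) refl _ _ _ ⟩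
    x * β x n                                  ∎
    where open ℤ-Solver

  β-unique : ∀ x U → U 0 ≈ 1# → ∂ U ⊕ θ U ≋ x ◂ U → U ≋ β x
  β-unique x U U₀ e zero    = trans U₀ (sym (*-identityʳ 1#))
  β-unique x U U₀ e (suc n) = ι-cancel n (begin
    ι (suc n) * U (suc n)                        ≈⟨ ·-ι (suc n) _ ⟨
    ∂ U n                                        ≈⟨ solve 2 (λ a b → a := a :+ b :- b) refl _ _ ⟩
    ∂ U n + θ U n - θ U n                        ≈⟨ +-cong (e n) (-‿cong (·-ι n _)) ⟩
    x * U n - ι n * U n                          ≈⟨ solve 3 (λ x i u → x :* u :- i :* u := (x :- i) :* u) refl _ _ _ ⟩
    (x - ι n) * U n                              ≈⟨ *-congˡ (β-unique x U U₀ e n) ⟩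
    (x - ι n) * β x n                            ≈⟨ β-suc x n ⟨
    ι (suc n) * β x (suc n)                      ∎)
    where open ℤ-Solver

  -- The product of two solutions solves the equation of the added exponents, and solutions are
  -- unique. This covers arbitrary field elements, as interpolation needs for the pair y and k - y.
  vandermonde : ∀ x y → β x ⊛ β y ≋ β (x + y)
  vandermonde x y = β-unique (x + y) (β x ⊛ β y)
    (solve 0 (con (+ 1) :* con (+ 1) :* (con (+ 1) :* con (+ 1)) := con (+ 1)) refl) λ n → begin
      ∂ (β x ⊛ β y) n + θ (β x ⊛ β y) n
        ≈⟨ +-cong (∂-⊛ (β x) (β y) n) (θ-⊛ (β x) (β y) n) ⟩
      ((∂ (β x) ⊛ β y) n + (β x ⊛ ∂ (β y)) n) + ((θ (β x) ⊛ β y) n + (β x ⊛ θ (β y)) n)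
        ≈⟨ solve 4 (λ a b c d → (a :+ b) :+ (c :+ d) := (a :+ c) :+ (b :+ d)) refl _ _ _ _ ⟩
      ((∂ (β x) ⊛ β y) n + (θ (β x) ⊛ β y) n) + ((β x ⊛ ∂ (β y)) n + (β x ⊛ θ (β y)) n)
        ≈⟨ +-cong (≋.distribʳ (β y) (∂ (β x)) (θ (β x)) n) (≋.distribˡ (β x) (∂ (β y)) (θ (β y)) n) ⟨
      ((∂ (β x) ⊕ θ (β x)) ⊛ β y) n + (β x ⊛ (∂ (β y) ⊕ θ (β y))) n
        ≈⟨ +-cong (⊛-cong (β-equation x) ≋.refl n) (⊛-cong {U = β x} ≋.refl (β-equation y) n) ⟩
      ((x ◂ β x) ⊛ β y) n + (β x ⊛ (y ◂ β y)) n
        ≈⟨ +-cong (◂-⊛ x (β x) (β y) n) (⊛-◂ y (β x) (β y) n) ⟩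
      x * (β x ⊛ β y) n + y * (β x ⊛ β y) n
        ≈⟨ distribʳ _ _ _ ⟨
      (x + y) * (β x ⊛ β y) n ∎
    where open ℤ-Solver

  -- Polynomial functions of degree ≤ k, in a Horner form with shifted argument: by β-absorb the shift
  -- turns interpolation at y in degree k + 1 into interpolation at y - 1 in degree k.
  Poly : ℕ → (Carrier → Carrier) → Set (c ⊔ ℓ)
  Poly zero    f = ∃ λ a → ∀ x → f x ≈ a
  Poly (suc k) f = ∃ λ a → ∃ λ q → Poly k q × (∀ x → f x ≈ a + x * q (x - 1#))

  -- A function on the carrier need not respect `≈`; one with a Horner form does. Rewriting the
  -- exponent inside `p` and `σ` rests on this.
  poly-cong : ∀ k {f} → Poly k f → ∀ {x y} → x ≈ y → f x ≈ f y
  poly-cong zero    (a , e)         {x} {y} d = trans (e x) (sym (e y))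
  poly-cong (suc k) (a , q , pq , e) {x} {y} d =
    trans (e x) (trans (+-congˡ (*-cong d (poly-cong k pq (+-congʳ d)))) (sym (e y)))

  poly-≈ : ∀ k {f g} → (∀ x → f x ≈ g x) → Poly k f → Poly k g
  poly-≈ zero    d (a , e)          = a , λ x → trans (sym (d x)) (e x)
  poly-≈ (suc k) d (a , q , pq , e) = a , q , pq , λ x → trans (sym (d x)) (e x)

  poly-const : ∀ k a → Poly k (λ _ → a)
  poly-const zero    a = a , λ _ → refl
  poly-const (suc k) a = a , (λ _ → 0#) , poly-const k 0# ,
    λ x → sym (trans (+-congˡ (zeroʳ x)) (+-identityʳ a))

  poly-+ : ∀ k {f g} → Poly k f → Poly k g → Poly k (λ x → f x + g x)
  poly-+ zero    (a , e) (b , d) = a + b , λ x → +-cong (e x) (d x)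
  poly-+ (suc k) (a , q , pq , e) (b , r , pr , d) =
    a + b , (λ x → q x + r x) , poly-+ k pq pr , λ x → trans (+-cong (e x) (d x))
      (solve 5 (λ a b x q r → a :+ x :* q :+ (b :+ x :* r) := a :+ b :+ x :* (q :+ r)) refl _ _ _ _ _)
    where open ℤ-Solver

  poly-scale : ∀ k b {f} → Poly k f → Poly k (λ x → b * f x)
  poly-scale zero    b (a , e) = b * a , λ x → *-congˡ (e x)
  poly-scale (suc k) b (a , q , pq , e) =
    b * a , (λ x → b * q x) , poly-scale k b pq , λ x → trans (*-congˡ (e x))
      (solve 4 (λ b a x q → b :* (a :+ x :* q) := b :* a :+ x :* (b :* q)) refl _ _ _ _)
    where open ℤ-Solver

  poly-suc : ∀ k {f} → Poly k f → Poly (suc k) f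
  poly-suc zero    (a , e) = poly-≈ 1 (λ x → sym (e x)) (poly-const 1 a)
  poly-suc (suc k) (a , q , pq , e) = a , q , poly-suc k pq , e

  poly-mono : ∀ {j k f} → j ≤ k → Poly j f → Poly k f
  poly-mono {j} {k} {f} j≤k p = go (ℕₚ.≤⇒≤′ j≤k)
    where
    go : ∀ {k} → j ℕ.≤′ k → Poly k f
    go (ℕ.≤′-reflexive ≡.refl) = p
    go (ℕ.≤′-step {n} j≤n) = poly-suc n (go j≤n)

  poly-shift : ∀ k {f} → Poly k f → Poly k (λ x → f (x + 1#))
  poly-shift zero    (a , e) = a , λ x → e (x + 1#)
  poly-shift (suc k) (a , q , pq , e) = poly-≈ (suc k)
    (λ x → sym (begin
      _ ≈⟨ e (x + 1#) ⟩
      a + (x + 1#) * q (x + 1# - 1#)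
        ≈⟨ +-congˡ (*-congˡ (poly-cong k pq (solve 2 (λ x o → x :+ o :- o := x) refl x 1#))) ⟩
      a + (x + 1#) * q x
        ≈⟨ solve 3 (λ a x q → a :+ (x :+ con (+ 1)) :* q := a :+ q :+ x :* q) refl a x (q x) ⟩
      a + q x + x * q x
        ≈⟨ +-congˡ (*-congˡ (poly-cong k pq (solve 2 (λ x o → x := x :- o :+ o) refl x 1#))) ⟩
      a + q x + x * q (x - 1# + 1#) ∎))
    (poly-+ (suc k) (poly-suc k (poly-+ k (poly-const k a) pq))
      (0# , _ , poly-shift k pq , λ x → sym (+-identityˡ _)))
    where open ℤ-Solver

  -- The Horner form reads its quotient at x - 1, so the quotient of x f(x) has to be f(x + 1).
  poly-x* : ∀ k {f} → Poly k f → Poly (suc k) (λ x → x * f x)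
  poly-x* k {f} pf = 0# , _ , poly-shift k pf , λ x → trans
    (*-congˡ (poly-cong k pf (solve 2 (λ x o → x := x :- o :+ o) refl x 1#))) (sym (+-identityˡ _))
    where open ℤ-Solver

  poly-reflect : ∀ k b {f} → Poly k f → Poly k (λ x → f (b - x))
  poly-reflect zero    b (a , e) = a , λ x → e (b - x)
  poly-reflect (suc k) b (a , q , pq , e) = poly-≈ (suc k)
    (λ x → sym (begin
      _ ≈⟨ e (b - x) ⟩
      a + (b - x) * q (b - x - 1#)
        ≈⟨ +-congˡ (*-congˡ (poly-cong k pq (solve 3 (λ b x o → b :- x :- o := b :- o :- x) refl b x 1#))) ⟩
      a + (b - x) * q (b - 1# - x)
        ≈⟨ solve 4 (λ a b x q → a :+ (b :- x) :* q := a :+ b :* q :+ con ℤ.-1ℤ :* (x :* q))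
             refl a b x (q (b - 1# - x)) ⟩
      a + b * q (b - 1# - x) + - 1# * (x * q (b - 1# - x)) ∎))
    (poly-+ (suc k)
      (poly-suc k (poly-+ k (poly-const k a) (poly-scale k b pq′)))
      (poly-scale (suc k) ((- 1#)) (poly-x* k pq′)))
    where
    open ℤ-Solver
    pq′ : Poly k (λ x → q (b - 1# - x))
    pq′ = poly-reflect k (b - 1#) pq

  poly-Σ : ∀ k n {f : ℕ → Carrier → Carrier} → (∀ i → i < n → Poly k (f i)) →
           Poly k (λ x → Σ< n (λ i → f i x))
  poly-Σ k zero    p = poly-const k 0#
  poly-Σ k (suc n) p = poly-+ k (p 0 (s≤s z≤n)) (poly-Σ k n (λ i i<n → p (suc i) (s≤s i<n)))

  -- The weights are the Lagrange basis polynomials for the nodes 0, ..., k, but no roots are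
  -- counted. On the Horner constant of f the weights add up to binom(k, k) = 1 by Vandermonde. On
  -- the rest, j binom(y, j) = y binom(y - 1, j - 1) leads to the sum for k - 1 and y - 1, and the
  -- upper index k - y does not change.
  interpolation : ∀ k {f} → Poly k f → ∀ y →
    Σ< (suc k) (λ j → β (ι k - y) (k ∸ j) * β y j * f (ι j)) ≈ f y
  interpolation zero {f} (a , e) y = begin
    1# * 1# * (1# * 1#) * f 0# + 0#
      ≈⟨ solve 1 (λ x → con (+ 1) :* con (+ 1) :* (con (+ 1) :* con (+ 1)) :* x :+ con (+ 0) := x) refl _ ⟩
    f 0#  ≈⟨ trans (e 0#) (sym (e y)) ⟩
    f y   ∎
    where open ℤ-Solver
  interpolation (suc k) {f} (a , q , pq , e) y = begin
    Σ< (suc (suc k)) (λ j → b j * f (ι j))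
      ≈⟨ Σ<-cong (suc (suc k)) (λ j _ → trans (*-congˡ (e (ι j)))
           (solve 4 (λ b a i q → b :* (a :+ i :* q) := a :* b :+ b :* i :* q) refl (b j) a (ι j) (q (ι j - 1#)))) ⟩
    Σ< (suc (suc k)) (λ j → a * b j + b j * ι j * q (ι j - 1#))
      ≈⟨ Σ<-+ (suc (suc k)) (λ j → a * b j) (λ j → b j * ι j * q (ι j - 1#)) ⟩
    Σ< (suc (suc k)) (λ j → a * b j) + Σ< (suc (suc k)) (λ j → b j * ι j * q (ι j - 1#))
      ≈⟨ +-cong constant linear ⟩
    a + y * q (y - 1#)
      ≈⟨ e y ⟨
    f y ∎
    where
    open ℤ-Solver
    b : ℕ → Carrier
    b j = β (ι (suc k) - y) (suc k ∸ j) * β y j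
    constant : Σ< (suc (suc k)) (λ j → a * b j) ≈ a
    constant = begin
      Σ< (suc (suc k)) (λ j → a * b j)               ≈⟨ Σ<-*ˡ (suc (suc k)) a b ⟩
      a * Σ< (suc (suc k)) b                         ≈⟨ *-congˡ (Σ<-cong (suc (suc k)) (λ j _ → *-comm (β (ι (suc k) - y) (suc k ∸ j)) (β y j))) ⟩
      a * Σ< (suc (suc k)) (λ j → β y j * β (ι (suc k) - y) (suc k ∸ j))
                                                     ≈⟨ *-congˡ (⊛-Σ (β y) (β (ι (suc k) - y)) (suc k)) ⟨
      a * (β y ⊛ β (ι (suc k) - y)) (suc k)          ≈⟨ *-congˡ (vandermonde y (ι (suc k) - y) (suc k)) ⟩
      a * β (y + (ι (suc k) - y)) (suc k)
        ≈⟨ *-congˡ (β-cong (suc k) (solve 2 (λ y i → y :+ (i :- y) := i) refl y (ι (suc k)))) ⟩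
      a * β (ι (suc k)) (suc k)                      ≈⟨ *-congˡ (β-diagonal (suc k)) ⟩
      a * 1#                                         ≈⟨ *-identityʳ a ⟩
      a                                              ∎
    step : ∀ i → b (suc i) * ι (suc i) * q (ι (suc i) - 1#) ≈
                 y * (β (ι k - (y - 1#)) (k ∸ i) * β (y - 1#) i * q (ι i))
    step i = begin
      β (ι (suc k) - y) (k ∸ i) * β y (suc i) * ι (suc i) * q (ι (suc i) - 1#)
        ≈⟨ *-cong (trans (*-assoc _ _ _) (*-cong
             (β-cong (k ∸ i) (solve 3 (λ o k y → o :+ k :- y := k :- (y :- o)) refl 1# (ι k) y))
             (trans (*-comm _ _) (β-absorb y i))))
             (poly-cong k pq (solve 2 (λ o i → o :+ i :- o := i) refl 1# (ι i))) ⟩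
      β (ι k - (y - 1#)) (k ∸ i) * (y * β (y - 1#) i) * q (ι i)
        ≈⟨ solve 4 (λ a b c d → a :* (b :* c) :* d := b :* (a :* c :* d)) refl _ _ _ _ ⟩
      y * (β (ι k - (y - 1#)) (k ∸ i) * β (y - 1#) i * q (ι i)) ∎
    linear : Σ< (suc (suc k)) (λ j → b j * ι j * q (ι j - 1#)) ≈ y * q (y - 1#)
    linear = begin
      b 0 * 0# * q (0# - 1#) + Σ< (suc k) (λ i → b (suc i) * ι (suc i) * q (ι (suc i) - 1#))
        ≈⟨ +-cong (trans (*-congʳ (zeroʳ _)) (zeroˡ _)) (Σ<-cong (suc k) (λ i _ → step i)) ⟩
      0# + Σ< (suc k) (λ i → y * (β (ι k - (y - 1#)) (k ∸ i) * β (y - 1#) i * q (ι i)))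
        ≈⟨ trans (+-identityˡ _) (Σ<-*ˡ (suc k) y (λ i → β (ι k - (y - 1#)) (k ∸ i) * β (y - 1#) i * q (ι i))) ⟩
      y * Σ< (suc k) (λ i → β (ι k - (y - 1#)) (k ∸ i) * β (y - 1#) i * q (ι i))
        ≈⟨ *-congˡ (interpolation k pq (y - 1#)) ⟩
      y * q (y - 1#) ∎

-- Powers of a series with arbitrary exponent, and Lagrange inversion.

module Powers {c ℓ} (F : CharZeroField c ℓ) where
  open CharZeroField F
  open Scalars F
  open Sums commRing
  open PowerSeries commRing
  open SetoidReasoning setoid
  open SemiringMult semiring using (×-homo-+)
  module SeriesExp = Exponentiation ≋.commutativeSemiring

  -- Coefficient n + 1 of `step U` uses all coefficients of `U` up to n through a convolution, which
  -- is no structural recursion. Iterating from `𝟘` settles one more coefficient each time, so the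
  -- diagonal of the iterates is the fixed point.
  module Recursion (a : Carrier) (u v W : Series) where
    step : Series → Series
    step U zero    = a
    step U (suc n) = u n + v n * (W ⊛ U) n

    iterate : ℕ → Series
    iterate zero    = 𝟘
    iterate (suc j) = step (iterate j)

    step-causal : ∀ U V n → (∀ i → i < n → U i ≈ V i) → step U n ≈ step V n
    step-causal U V zero    e = refl
    step-causal U V (suc n) e =
      +-congˡ (*-congˡ (⊛-cong-≤ n {U = W} (λ _ _ → refl) (λ i i≤n → e i (s≤s i≤n))))

    iterate-stable : ∀ j j′ n → n < j → n < j′ → iterate j n ≈ iterate j′ n
    iterate-stable (suc j) (suc j′) n (s≤s n≤j) (s≤s n≤j′) = step-causal (iterate j) (iterate j′) n
      λ i i<n → iterate-stable j j′ i (ℕₚ.<-≤-trans i<n n≤j) (ℕₚ.<-≤-trans i<n n≤j′)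

    solution : Series
    solution n = iterate (suc n) n

    solution-suc : ∀ n → solution (suc n) ≈ u n + v n * (W ⊛ solution) n
    solution-suc n = step-causal (iterate (suc n)) solution (suc n)
      λ i i<n → iterate-stable (suc n) (suc i) i i<n ℕₚ.≤-refl

  module GeneralPower (G : Series) (G₀ : G 0 ≈ 1#) where
    open ℤ-Solver

    private
      module LogRec = Recursion (∂ G 0) (tail (∂ G)) (λ _ → - 1#) (tail G)

    -- This is ∂ G / G without a division of series: as G 0 = 1, coefficient n + 1 of G L = ∂ G
    -- expresses L (n + 1) by ∂ G and the convolution of `tail G` with L in degree n.
    logDerivative : Series
    logDerivative = LogRec.solution

    private
      L : Series
      L = logDerivative

    logDerivative-equation : L ⊛ G ≋ ∂ G
    logDerivative-equation n = trans (⊛-comm L G n) (go n)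
      where
      go : G ⊛ L ≋ ∂ G
      go zero    = trans (*-congʳ G₀) (*-identityˡ _)
      go (suc n) = begin
        G 0 * L (suc n) + (tail G ⊛ L) n
          ≈⟨ +-congʳ (*-cong G₀ (LogRec.solution-suc n)) ⟩
        1# * (∂ G (suc n) + - 1# * (tail G ⊛ L) n) + (tail G ⊛ L) n
          ≈⟨ solve 2 (λ g t → con (+ 1) :* (g :+ con ℤ.-1ℤ :* t) :+ t := g) refl _ _ ⟩
        ∂ G (suc n) ∎

    private
      module PowRec (x : Carrier) = Recursion 1# 𝟘 (λ n → x * ι⁻¹ n) L

    -- p x is the series G ^ x, the solution of ∂ U = x (∂ G / G) U with U 0 = 1.
    p : Carrier → Series
    p x = PowRec.solution x

    -- The quotient of `p x (suc n)` by x, as a function defined at x = 0 too. The exact division in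
    -- `r` goes through it.
    σ : Carrier → Series
    σ x n = ι⁻¹ n * (L ⊛ p x) n

    p-suc : ∀ x n → p x (suc n) ≈ x * σ x n
    p-suc x n = trans (PowRec.solution-suc x n) (trans (+-identityˡ _) (*-assoc _ _ _))

    ∂p : ∀ x → ∂ (p x) ≋ x ◂ (L ⊛ p x)
    ∂p x n = begin
      suc n · p x (suc n)                       ≈⟨ ·-ι (suc n) _ ⟩
      ι (suc n) * p x (suc n)                   ≈⟨ *-congˡ (p-suc x n) ⟩
      ι (suc n) * (x * (ι⁻¹ n * (L ⊛ p x) n))
        ≈⟨ solve 4 (λ a b c d → a :* (b :* (c :* d)) := a :* c :* (b :* d)) refl _ _ _ _ ⟩
      ι (suc n) * ι⁻¹ n * (x * (L ⊛ p x) n)     ≈⟨ *-congʳ (ι⁻¹-inverse n) ⟩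
      1# * (x * (L ⊛ p x) n)                    ≈⟨ *-identityˡ _ ⟩
      x * (L ⊛ p x) n                           ∎

    -- Strong induction: in degree i the equation involves all coefficients of `U` up to i, so the
    -- inner induction carries a bound n.
    p-unique : ∀ x U → U 0 ≈ 1# → ∂ U ≋ x ◂ (L ⊛ U) → U ≋ p x
    p-unique x U U₀ e n = go n n ℕₚ.≤-refl
      where
      go : ∀ n i → i ≤ n → U i ≈ p x i
      go n       zero    _         = U₀
      go (suc n) (suc i) (s≤s i≤n) = ι-cancel i (begin
        ι (suc i) * U (suc i)      ≈⟨ ·-ι (suc i) _ ⟨
        ∂ U i                      ≈⟨ e i ⟩
        x * (L ⊛ U) i
          ≈⟨ *-congˡ (⊛-cong-≤ i {U = L} (λ _ _ → refl) (λ j j≤i → go n j (ℕₚ.≤-trans j≤i i≤n))) ⟩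
        x * (L ⊛ p x) i            ≈⟨ ∂p x i ⟨
        ∂ (p x) i                  ≈⟨ ·-ι (suc i) _ ⟩
        ι (suc i) * p x (suc i)    ∎)

    p-+ : ∀ x y → p x ⊛ p y ≋ p (x + y)
    p-+ x y = p-unique (x + y) (p x ⊛ p y) (*-identityʳ 1#) λ n → begin
      ∂ (p x ⊛ p y) n                             ≈⟨ ∂-⊛ (p x) (p y) n ⟩
      (∂ (p x) ⊛ p y) n + (p x ⊛ ∂ (p y)) n
        ≈⟨ +-cong (⊛-cong (∂p x) ≋.refl n) (⊛-cong {U = p x} ≋.refl (∂p y) n) ⟩
      ((x ◂ (L ⊛ p x)) ⊛ p y) n + (p x ⊛ (y ◂ (L ⊛ p y))) n
        ≈⟨ +-cong (◂-⊛ x (L ⊛ p x) (p y) n) (⊛-◂ y (p x) (L ⊛ p y) n) ⟩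
      x * ((L ⊛ p x) ⊛ p y) n + y * (p x ⊛ (L ⊛ p y)) n
        ≈⟨ +-cong (*-congˡ (⊛-assoc L (p x) (p y) n)) (*-congˡ (swap n)) ⟩
      x * (L ⊛ (p x ⊛ p y)) n + y * (L ⊛ (p x ⊛ p y)) n ≈⟨ distribʳ _ _ _ ⟨
      (x + y) * (L ⊛ (p x ⊛ p y)) n               ∎
      where
      swap : p x ⊛ (L ⊛ p y) ≋ L ⊛ (p x ⊛ p y)
      swap = ≋.trans (≋.sym (⊛-assoc (p x) L (p y)))
        (≋.trans (⊛-cong (⊛-comm (p x) L) ≋.refl) (⊛-assoc L (p x) (p y)))

    p-0 : 𝟙 ≋ p 0#
    p-0 = p-unique 0# 𝟙 refl λ n → trans (·-ι (suc n) _) (trans (zeroʳ _) (sym (zeroˡ _)))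

    p-1 : G ≋ p 1#
    p-1 = p-unique 1# G G₀ λ n → trans (sym (logDerivative-equation n)) (sym (*-identityˡ _))

    p-ι : ∀ m → G SeriesExp.^ m ≋ p (ι m)
    p-ι zero    = p-0
    p-ι (suc m) = ≋.trans (⊛-cong p-1 (p-ι m)) (p-+ 1# (ι m))

    -- `σ x n` combines p x 0, ..., p x n with coefficients free of x, and the factor x in `p-suc`
    -- then raises the degree by one. The two statements are mutually recursive; the bound n of the
    -- private versions is what decreases.
    σ-poly : ∀ n → Poly n (λ x → σ x n)
    p-poly : ∀ n → Poly n (λ x → p x n)

    private
      p-poly-≤ : ∀ n i → i ≤ n → Poly i (λ x → p x i)
      σ-poly-≤ : ∀ n i → i ≤ n → Poly i (λ x → σ x i)

      p-poly-≤ n       zero    _         = poly-const 0 1#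
      p-poly-≤ (suc n) (suc i) (s≤s i≤n) =
        poly-≈ (suc i) (λ x → sym (p-suc x i)) (poly-x* i (σ-poly-≤ n i i≤n))

      σ-poly-≤ n i i≤n = poly-scale i (ι⁻¹ i) (poly-≈ i (λ x → sym (⊛-Σ L (p x) i))
        (poly-Σ i (suc i) λ j _ → poly-scale i (L j)
          (poly-mono (ℕₚ.m∸n≤m i j) (p-poly-≤ n (i ∸ j) (ℕₚ.≤-trans (ℕₚ.m∸n≤m i j) i≤n)))))

    σ-poly n = σ-poly-≤ n n ℕₚ.≤-refl
    p-poly n = p-poly-≤ n n ℕₚ.≤-refl

    -- r x k = (x / (x + k)) p (- k - x) k, which are the coefficients attached to the inverse
    -- series (Lagrange inversion); the division is exact because p x k is divisible by x.
    r : Carrier → Series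
    r x zero    = 1#
    r x (suc k) = - 1# * (x * σ (- ι (suc k) - x) k)

    r-poly : ∀ k → Poly k (λ x → r x k)
    r-poly zero    = poly-const 0 1#
    r-poly (suc k) = poly-scale (suc k) (- 1#) (poly-x* k (poly-reflect k (- ι (suc k)) (σ-poly k)))

    -- For k ≥ 1 and y = -k - x the factor x + k is -y, which restores the factor that `σ` had
    -- divided out of `p` at y. This denominator-free relation is all that Lagrange inversion uses
    -- of `r`.
    r-p : ∀ x k → (x + ι k) * r x k ≈ x * p (- ι k - x) k
    r-p x zero    = *-congʳ (+-identityʳ x)
    r-p x (suc k) = begin
      (x + ι (suc k)) * (- 1# * (x * σ y k))
        ≈⟨ solve 3 (λ x i s → (x :+ i) :* (con ℤ.-1ℤ :* (x :* s)) := x :* ((:- i :- x) :* s)) refl _ _ _ ⟩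
      x * (y * σ y k)             ≈⟨ *-congˡ (p-suc y k) ⟨
      x * p y (suc k)             ∎
      where
      y : Carrier
      y = - ι (suc k) - x

    -- A formal residue computation. Put N = K + 1 and n = m + N. After multiplication by n, which
    -- is nonzero, `r-p` turns each term into (m + s) times coefficient s of G^m times coefficient N
    -- - s of G^(-n). So the sum is the coefficient of t^N in m G^m G^(-n) + θ(G^m) G^(-n) = m
    -- (G^(-N) + t G' G^(-N-1)). It vanishes: t G' G^(-N-1) is -1/N times θ(G^(-N)), and θ
    -- multiplies this coefficient by N.
    lagrange : ∀ m K → Σ< (suc (suc K)) (λ s → r (ι (m ℕ.+ s)) (suc K ∸ s) * p (ι m) s) ≈ 0#
    lagrange m K = ι-cancel (m ℕ.+ K) (begin
      ι n * Σ< (suc N) (λ s → r (ι (m ℕ.+ s)) (N ∸ s) * p (ι m) s)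
        ≈⟨ Σ<-*ˡ (suc N) (ι n) (λ s → r (ι (m ℕ.+ s)) (N ∸ s) * p (ι m) s) ⟨
      Σ< (suc N) (λ s → ι n * (r (ι (m ℕ.+ s)) (N ∸ s) * p (ι m) s))
        ≈⟨ Σ<-cong (suc N) (λ s s<N → term s (ℕₚ.≤-pred s<N)) ⟩
      Σ< (suc N) (λ s → ι m * (U s * V (N ∸ s)) + θ U s * V (N ∸ s))
        ≈⟨ Σ<-+ (suc N) (λ s → ι m * (U s * V (N ∸ s))) (λ s → θ U s * V (N ∸ s)) ⟩
      Σ< (suc N) (λ s → ι m * (U s * V (N ∸ s))) + Σ< (suc N) (λ s → θ U s * V (N ∸ s))
        ≈⟨ +-cong (Σ<-*ˡ (suc N) (ι m) (λ s → U s * V (N ∸ s))) (sym (⊛-Σ (θ U) V N)) ⟩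
      ι m * Σ< (suc N) (λ s → U s * V (N ∸ s)) + (θ U ⊛ V) N
        ≈⟨ +-cong (*-congˡ (sym (⊛-Σ U V N))) (trans (+-congʳ (zeroˡ _)) (+-identityˡ _)) ⟩
      ι m * (U ⊛ V) N + (∂ U ⊛ V) K
        ≈⟨ +-cong (*-congˡ (p-+ (ι m) (- ι n) N)) derivative ⟩
      ι m * p z N + ι m * (L ⊛ p z) K
        ≈⟨ +-congʳ (*-congˡ pzN) ⟩
      ι m * (- 1# * (L ⊛ p z) K) + ι m * (L ⊛ p z) K
        ≈⟨ solve 2 (λ m x → m :* (con ℤ.-1ℤ :* x) :+ m :* x := con (+ 0)) refl _ _ ⟩
      0#
        ≈⟨ zeroʳ _ ⟨
      ι n * 0# ∎)
      where
      N n : ℕ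
      N = suc K
      n = suc (m ℕ.+ K)
      U V : Series
      U = p (ι m)
      V = p (- ι n)
      z : Carrier
      z = ι m - ι n

      z≈-N : z ≈ - ι N
      z≈-N = begin
        ι m - (1# + ι (m ℕ.+ K))     ≈⟨ +-congˡ (-‿cong (+-congˡ (×-homo-+ 1# m K))) ⟩
        ι m - (1# + (ι m + ι K))     ≈⟨ solve 3 (λ m o k → m :- (o :+ (m :+ k)) := :- (o :+ k)) refl _ _ _ ⟩
        - ι N                        ∎

      derivative : (∂ U ⊛ V) K ≈ ι m * (L ⊛ p z) K
      derivative = begin
        (∂ U ⊛ V) K                  ≈⟨ ⊛-cong (∂p (ι m)) ≋.refl K ⟩
        ((ι m ◂ (L ⊛ U)) ⊛ V) K      ≈⟨ ◂-⊛ (ι m) (L ⊛ U) V K ⟩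
        ι m * ((L ⊛ U) ⊛ V) K        ≈⟨ *-congˡ (⊛-assoc L U V K) ⟩
        ι m * (L ⊛ (U ⊛ V)) K        ≈⟨ *-congˡ (⊛-cong {U = L} ≋.refl (p-+ (ι m) (- ι n)) K) ⟩
        ι m * (L ⊛ p z) K            ∎

      pzN : p z N ≈ - 1# * (L ⊛ p z) K
      pzN = begin
        p z N                              ≈⟨ p-suc z K ⟩
        z * (ι⁻¹ K * (L ⊛ p z) K)          ≈⟨ *-congʳ z≈-N ⟩
        - ι N * (ι⁻¹ K * (L ⊛ p z) K)
          ≈⟨ solve 3 (λ n i x → :- n :* (i :* x) := con ℤ.-1ℤ :* (n :* i :* x)) refl _ _ _ ⟩
        - 1# * (ι N * ι⁻¹ K * (L ⊛ p z) K) ≈⟨ *-congˡ (trans (*-congʳ (ι⁻¹-inverse K)) (*-identityˡ _)) ⟩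
        - 1# * (L ⊛ p z) K                 ∎

      term : ∀ s → s ≤ N → ι n * (r (ι (m ℕ.+ s)) (N ∸ s) * p (ι m) s) ≈
                           ι m * (U s * V (N ∸ s)) + θ U s * V (N ∸ s)
      term s s≤N = begin
        ι n * (r x (N ∸ s) * U s)              ≈⟨ *-assoc _ _ _ ⟨
        ι n * r x (N ∸ s) * U s                ≈⟨ *-congʳ (*-congʳ n≈) ⟩
        (x + ι (N ∸ s)) * r x (N ∸ s) * U s    ≈⟨ *-congʳ (r-p x (N ∸ s)) ⟩
        x * p (- ι (N ∸ s) - x) (N ∸ s) * U s  ≈⟨ *-congʳ (*-congˡ (poly-cong (N ∸ s) (p-poly (N ∸ s)) (begin
          - ι (N ∸ s) - x                        ≈⟨ solve 2 (λ a b → :- a :- b := :- (b :+ a)) refl _ _ ⟩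
          - (x + ι (N ∸ s))                      ≈⟨ -‿cong n≈ ⟨
          - ι n                                  ∎))) ⟩
        x * V (N ∸ s) * U s                    ≈⟨ *-congʳ (*-congʳ (×-homo-+ 1# m s)) ⟩
        (ι m + ι s) * V (N ∸ s) * U s
          ≈⟨ solve 4 (λ m s v u → (m :+ s) :* v :* u := m :* (u :* v) :+ s :* u :* v) refl _ _ _ _ ⟩
        ι m * (U s * V (N ∸ s)) + ι s * U s * V (N ∸ s)   ≈⟨ +-congˡ (*-congʳ (·-ι s _)) ⟨
        ι m * (U s * V (N ∸ s)) + θ U s * V (N ∸ s)   ∎
        where
        x : Carrier
        x = ι (m ℕ.+ s)
        n≈ : ι n ≈ x + ι (N ∸ s)
        n≈ = trans (reflexive (≡.cong ι (≡.trans (≡.sym (ℕₚ.+-suc m K)) (≡.trans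
          (≡.cong (m ℕ.+_) (≡.sym (ℕₚ.m+[n∸m]≡n s≤N))) (≡.sym (ℕₚ.+-assoc m s (N ∸ s)))))))
          (×-homo-+ 1# (m ℕ.+ s) (N ∸ s))

-- Integrality of the coefficients of Bell polynomials.

m!*n!∣[m+n]! : ∀ m n → m ! ℕ.* n ! ∣ (m ℕ.+ n) !
m!*n!∣[m+n]! m n =
  ≡.subst (λ j → m ! ℕ.* j ! ∣ (m ℕ.+ n) !) (ℕₚ.m+n∸m≡n m n) (k![n∸k]!∣n! (ℕₚ.m≤m+n m n))

-- The quotient counts the partitions of (i+1) r points into r blocks of size i+1. In the step, the
-- leading factor (i+1)(r+1) of ((i+1)(r+1))! completes i! to (i+1)! and r! to (r+1)!; what remains
-- is divisible by i! ((i+1) r)!.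
r!*i!^r∣[i*r]! : ∀ i r → r ! ℕ.* (suc i !) ℕ.^ r ∣ (suc i ℕ.* r) !
r!*i!^r∣[i*r]! i zero    = 1∣ _
r!*i!^r∣[i*r]! i (suc r) = ≡.subst₂ _∣_ (≡.sym lhs) (≡.sym rhs)
  (*-monoʳ-∣ (suc i ℕ.* suc r)
    (∣-trans (*-pres-∣ (∣-refl {i !}) (r!*i!^r∣[i*r]! i r)) (m!*n!∣[m+n]! i (suc i ℕ.* r))))
  where
  regroup : ∀ a b c d e → (a ℕ.* b) ℕ.* ((c ℕ.* d) ℕ.* e) ≡ (c ℕ.* a) ℕ.* (d ℕ.* (b ℕ.* e))
  regroup = solve-∀
  lhs : suc r ! ℕ.* (suc i !) ℕ.^ suc r ≡ (suc i ℕ.* suc r) ℕ.* (i ! ℕ.* (r ! ℕ.* (suc i !) ℕ.^ r))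
  lhs = regroup (suc r) (r !) (suc i) (i !) ((suc i !) ℕ.^ r)
  size : ∀ i r → suc i ℕ.* suc r ≡ suc (i ℕ.+ suc i ℕ.* r)
  size = solve-∀
  rhs : (suc i ℕ.* suc r) ! ≡ (suc i ℕ.* suc r) ℕ.* (i ℕ.+ suc i ℕ.* r) !
  rhs = ≡.trans (≡.cong _! (size i r)) (≡.cong (ℕ._* (i ℕ.+ suc i ℕ.* r) !) (≡.sym (size i r)))

-- `divℕ` truncates. Every tuple kept by `bellFormula` has weighted sum n, so this makes its
-- division exact.
denom∣wsum! : ∀ i rs → denom (suc i) rs ∣ (wsum (suc i) rs) !
denom∣wsum! i []       = ∣-refl
denom∣wsum! i (r ∷ rs) = ∣-trans (*-pres-∣ (r!*i!^r∣[i*r]! i r) (denom∣wsum! (suc i) rs))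
  (m!*n!∣[m+n]! (suc i ℕ.* r) (wsum (suc (suc i)) rs))

divℕ-exact : ∀ n d → d ∣ n → divℕ n d ℕ.* d ≡ n
-- Zero divides only zero, in agreement with the default value of `divℕ`.
divℕ-exact n zero    d∣n = ≡.sym (0∣⇒≡0 d∣n)
divℕ-exact n (suc d) d∣n = m/n*n≡m d∣n

-- Sums over lists and over exponent tuples.

module ListSums {c ℓ} (R : CommutativeRing c ℓ) where
  open CommutativeRing R
  open Sums R

  ΣL : ∀ {a} {A : Set a} → List A → (A → Carrier) → Carrier
  ΣL []       f = 0#
  ΣL (x ∷ xs) f = f x + ΣL xs f

  ΣL-cong : ∀ {a} {A : Set a} (xs : List A) {f g} → (∀ x → f x ≈ g x) → ΣL xs f ≈ ΣL xs g
  ΣL-cong []       e = refl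
  ΣL-cong (x ∷ xs) e = +-cong (e x) (ΣL-cong xs e)

  ΣL-zero : ∀ {a} {A : Set a} (xs : List A) {f} → (∀ x → f x ≈ 0#) → ΣL xs f ≈ 0#
  ΣL-zero []       e = refl
  ΣL-zero (x ∷ xs) e = trans (+-cong (e x) (ΣL-zero xs e)) (+-identityˡ 0#)

  ΣL-*ˡ : ∀ {a} {A : Set a} (xs : List A) y f → ΣL xs (λ x → y * f x) ≈ y * ΣL xs f
  ΣL-*ˡ []       y f = sym (zeroʳ y)
  ΣL-*ˡ (x ∷ xs) y f = trans (+-congˡ (ΣL-*ˡ xs y f)) (sym (distribˡ y _ _))

  ΣL-++ : ∀ {a} {A : Set a} (xs ys : List A) f → ΣL (xs ++ ys) f ≈ ΣL xs f + ΣL ys f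
  ΣL-++ []       ys f = sym (+-identityˡ _)
  ΣL-++ (x ∷ xs) ys f = trans (+-congˡ (ΣL-++ xs ys f)) (sym (+-assoc _ _ _))

  ΣL-map : ∀ {a b} {A : Set a} {B : Set b} (g : A → B) (xs : List A) f →
           ΣL (mapL g xs) f ≡ ΣL xs (f ∘ g)
  ΣL-map g []       f = ≡.refl
  ΣL-map g (x ∷ xs) f = ≡.cong (λ s → f (g x) + s) (ΣL-map g xs f)

  ΣL-concatMap : ∀ {a} {A : Set a} (h : ℕ → List A) (g : ℕ → ℕ) n f →
                 ΣL (concatMap h (applyUpTo g n)) f ≈ Σ< n (λ i → ΣL (h (g i)) f)
  ΣL-concatMap h g zero    f = refl
  ΣL-concatMap h g (suc n) f = trans (ΣL-++ (h (g 0)) _ f) (+-congˡ (ΣL-concatMap h (g ∘ suc) n f))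

  ΣL-tuples : ∀ l b f → ΣL (tuples (suc l) b) f ≈ Σ< (suc b) (λ r → ΣL (tuples l b) (λ rs → f (r ∷ rs)))
  ΣL-tuples l b f = trans (ΣL-concatMap (λ r → mapL (r ∷_) (tuples l b)) id (suc b) f)
    (Σ<-cong (suc b) (λ r _ → reflexive (ΣL-map (r ∷_) (tuples l b) f)))

-- Bell polynomials as coefficients of powers of a generating function.

module BellSeries {c ℓ} (F : CharZeroField c ℓ) where
  open CharZeroField F
  open FieldDefs F
  open Scalars F
  open Sums commRing
  open ListSums commRing
  open PowerSeries commRing
  open SetoidReasoning setoid
  open SemiringMult semiring using (×1-homo-*)
  open Exponentiation commutativeSemiring using (^-distrib-*)
  open ℤ-Solver using (solve; _:=_; _:*_)
  private
    module Exp = Exponentiation ≋.commutativeSemiring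
    module S  = Sums seriesRing
    module SL = ListSums seriesRing
    -- Series in u whose coefficients are series in t: u counts the blocks, t their total size.
    module P² = PowerSeries seriesRing
    module SMult = SemiringMult ≋.semiring

  ^-cong-≤ : ∀ n k {U V} → (∀ i → i ≤ n → U i ≈ V i) → ∀ i → i ≤ n → (U Exp.^ k) i ≈ (V Exp.^ k) i
  ^-cong-≤ n zero    e i i≤n = refl
  ^-cong-≤ n (suc k) e i i≤n = ⊛-cong-≤ i (λ j j≤i → e j (ℕₚ.≤-trans j≤i i≤n))
    (λ j j≤i → ^-cong-≤ n k e j (ℕₚ.≤-trans j≤i i≤n))

  -- The monomial a t^e.
  term : ℕ → Carrier → Series
  term zero    a zero    = a
  term zero    a (suc n) = 0#
  term (suc e) a zero    = 0#
  term (suc e) a (suc n) = term e a n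

  term-cong : ∀ e {a b} → a ≈ b → term e a ≋ term e b
  term-cong zero    d zero    = d
  term-cong zero    d (suc n) = refl
  term-cong (suc e) d zero    = refl
  term-cong (suc e) d (suc n) = term-cong e d n

  term-at : ∀ e a → term e a e ≈ a
  term-at zero    a = refl
  term-at (suc e) a = term-at e a

  term-off : ∀ e a n → e ≢ n → term e a n ≈ 0#
  term-off zero    a zero    e≢n = contradiction ≡.refl e≢n
  term-off zero    a (suc n) e≢n = refl
  term-off (suc e) a zero    e≢n = refl
  term-off (suc e) a (suc n) e≢n = term-off e a n (e≢n ∘ ≡.cong suc)

  ◂-term : ∀ b e a → b ◂ term e a ≋ term e (b * a)
  ◂-term b zero    a zero    = refl
  ◂-term b zero    a (suc n) = zeroʳ b
  ◂-term b (suc e) a zero    = zeroʳ b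
  ◂-term b (suc e) a (suc n) = ◂-term b e a n

  term-⊛ : ∀ e d a b → term e a ⊛ term d b ≋ term (e ℕ.+ d) (a * b)
  term-⊛ zero    d a b zero    = ◂-term a d b 0
  term-⊛ zero    d a b (suc n) =
    trans (+-cong (◂-term a d b (suc n)) (𝟘-⊛ (tail (term 0 a)) (term d b) (λ _ → refl) n)) (+-identityʳ _)
  term-⊛ (suc e) d a b zero    = zeroˡ _
  term-⊛ (suc e) d a b (suc n) = trans (+-congʳ (zeroˡ _)) (trans (+-identityˡ _) (term-⊛ e d a b n))

  ·-coefficient : ∀ k U n → (k SMult.× U) n ≈ k · U n
  ·-coefficient zero    U n = refl
  ·-coefficient (suc k) U n = +-congˡ (·-coefficient k U n)

  ΣL-coefficient : ∀ {a} {A : Set a} (xs : List A) f n → SL.ΣL xs f n ≡ ΣL xs (λ x → f x n)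
  ΣL-coefficient []       f n = ≡.refl
  ΣL-coefficient (x ∷ xs) f n = ≡.cong (λ s → f x n + s) (ΣL-coefficient xs f n)

  -- The constant term is 0 whatever `x 0` is, because Bell polynomials have no variable X_0.
  egf : (ℕ → Carrier) → Series
  egf x zero    = 0#
  egf x (suc i) = x (suc i) * φ (suc i)

  module Expansion (x : ℕ → Carrier) where
    f : Series
    f = egf x

    -- exp (u f_i t^i), as a series in u
    exponential : ℕ → P².Series
    exponential i r = term (i ℕ.* r) (φ r * f i ^ r)

    exponential-∂ : ∀ i → P².∂ (exponential i) P².≋ (term i (f i) P².◂ exponential i)
    exponential-∂ i r n = begin
      (suc r SMult.× exponential i (suc r)) n                ≈⟨ ·-coefficient (suc r) (exponential i (suc r)) n ⟩
      suc r · exponential i (suc r) n                        ≈⟨ ·-ι (suc r) _ ⟩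
      ι (suc r) * exponential i (suc r) n                    ≈⟨ ◂-term (ι (suc r)) (i ℕ.* suc r) _ n ⟩
      term (i ℕ.* suc r) (ι (suc r) * (φ (suc r) * (f i * f i ^ r))) n
        ≡⟨ ≡.cong (λ e → term e (ι (suc r) * (φ (suc r) * (f i * f i ^ r))) n) (ℕₚ.*-suc i r) ⟩
      term (i ℕ.+ i ℕ.* r) (ι (suc r) * (φ (suc r) * (f i * f i ^ r))) n
        ≈⟨ term-cong (i ℕ.+ i ℕ.* r) (trans
             (solve 4 (λ a b c d → a :* (b :* (c :* d)) := c :* (a :* b :* d)) refl _ _ _ _)
             (*-congˡ (*-congʳ (φ-suc r)))) n ⟩
      term (i ℕ.+ i ℕ.* r) (f i * (φ r * f i ^ r)) n         ≈⟨ term-⊛ i (i ℕ.* r) (f i) _ n ⟨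
      (term i (f i) ⊛ exponential i r) n                     ∎

    -- The product of f_i^r_i / r_i!, that is, a Bell monomial with its coefficient apart from n!;
    -- the powers of i! are already inside f.
    weight : ℕ → List ℕ → Carrier
    weight i []       = 1#
    weight i (r ∷ rs) = (φ r * f i ^ r) * weight (suc i) rs

    weightTerm : ℕ → List ℕ → Series
    weightTerm i rs = term (wsum i rs) (weight i rs)

    weight-monomial : ∀ i rs → monomial x (suc i) rs ≈ ι (denom (suc i) rs) * weight (suc i) rs
    weight-monomial i []       = sym (trans (*-identityʳ _) (+-identityʳ 1#))
    weight-monomial i (r ∷ rs) = begin
      X * monomial x (suc (suc i)) rs
        ≈⟨ *-congˡ (weight-monomial (suc i) rs) ⟩
      X * (ι D * w)
        ≈⟨ trans (*-congʳ (*-identityˡ _)) (*-identityˡ _) ⟨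
      1# * 1# * (X * (ι D * w))
        ≈⟨ *-congʳ (*-cong (!-φ r) (power-one r)) ⟨
      (ι (r !) * φ r) * (ι ((suc i !) ℕ.^ r) * φ (suc i) ^ r) * (X * (ι D * w))
        ≈⟨ solve 7 (λ a b c d e g h → (a :* b) :* (c :* d) :* (e :* (g :* h)) :=
                                      ((a :* c) :* g) :* ((b :* (e :* d)) :* h)) refl _ _ _ _ _ _ _ ⟩
      ((ι (r !) * ι ((suc i !) ℕ.^ r)) * ι D) * ((φ r * (X * φ (suc i) ^ r)) * w)
        ≈⟨ *-cong (trans (×1-homo-* (r ! ℕ.* (suc i !) ℕ.^ r) D) (*-congʳ (×1-homo-* (r !) _)))
             (*-congʳ (*-congˡ (^-distrib-* (x (suc i)) (φ (suc i)) r))) ⟨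
      ι (denom (suc i) (r ∷ rs)) * ((φ r * f (suc i) ^ r) * w) ∎
      where
      X w : Carrier
      X = x (suc i) ^ r
      w = weight (suc (suc i)) rs
      D : ℕ
      D = denom (suc (suc i)) rs
      power-one : ∀ r → ι ((suc i !) ℕ.^ r) * φ (suc i) ^ r ≈ 1#
      power-one zero    = trans (*-identityʳ _) (+-identityʳ 1#)
      power-one (suc r) = begin
        ι (suc i ! ℕ.* (suc i !) ℕ.^ r) * (φ (suc i) * φ (suc i) ^ r)
          ≈⟨ *-congʳ (×1-homo-* (suc i !) _) ⟩
        (ι (suc i !) * ι ((suc i !) ℕ.^ r)) * (φ (suc i) * φ (suc i) ^ r)
          ≈⟨ solve 4 (λ a b c d → (a :* b) :* (c :* d) := (a :* c) :* (b :* d)) refl _ _ _ _ ⟩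
        (ι (suc i !) * φ (suc i)) * (ι ((suc i !) ℕ.^ r) * φ (suc i) ^ r)
          ≈⟨ *-cong (!-φ (suc i)) (power-one r) ⟩
        1# * 1# ≈⟨ *-identityʳ 1# ⟩
        1# ∎

    -- Of the two tests in `bellFormula` only the one on the sum of the r_i is made here; the one on
    -- the weighted sum becomes the choice of a coefficient in t, through `weightTerm`.
    select : ℕ → ℕ → Series → Series
    select k m U = if ⌊ m ℕₚ.≟ k ⌋ then U else 𝟘

    restrictedSum : ℕ → ℕ → ℕ → ℕ → Series
    restrictedSum b l i k = SL.ΣL (tuples l b) (λ rs → select k (sumℕ rs) (weightTerm i rs))

    exponentialProduct : ℕ → ℕ → P².Series
    exponentialProduct zero    i = P².𝟙
    exponentialProduct (suc l) i = exponential i P².⊛ exponentialProduct l (suc i)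

    select-> : ∀ k r s U → k < r → select k (r ℕ.+ s) U ≋ 𝟘
    select-> k r s U k<r with (r ℕ.+ s) ℕₚ.≟ k
    ... | yes ≡.refl = contradiction (ℕₚ.m≤m+n r s) (ℕₚ.<⇒≱ k<r)
    ... | no _       = ≋.refl

    select-∷ : ∀ k r s i rs → r ≤ k →
      select k (r ℕ.+ s) (weightTerm i (r ∷ rs)) ≋ exponential i r ⊛ select (k ∸ r) s (weightTerm (suc i) rs)
    select-∷ k r s i rs r≤k with (r ℕ.+ s) ℕₚ.≟ k | s ℕₚ.≟ (k ∸ r)
    ... | yes _ | yes _ = ≋.sym (term-⊛ (i ℕ.* r) (wsum (suc i) rs) _ _)
    ... | yes p | no ¬q = contradiction (≡.trans (≡.sym (ℕₚ.m+n∸m≡n r s)) (≡.cong (_∸ r) p)) ¬q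
    ... | no ¬p | yes q = contradiction (≡.trans (≡.cong (r ℕ.+_) q) (ℕₚ.m+[n∸m]≡n r≤k)) ¬p
    ... | no _  | no _  = ≋.sym (≋.zeroʳ (exponential i r))

    -- Summing over the first entry is a Cauchy product in u. Entries are bounded by b, and k ≤ b
    -- ensures that the bound loses nothing: an entry above k already exceeds the prescribed total.
    restrictedSum≋ : ∀ b l i k → k ≤ b → restrictedSum b l i k ≋ exponentialProduct l i k
    restrictedSum≋ b zero    i zero    k≤b zero    = +-identityʳ 1#
    restrictedSum≋ b zero    i zero    k≤b (suc n) = +-identityʳ 0#
    restrictedSum≋ b zero    i (suc k) k≤b n       = +-identityʳ 0#
    restrictedSum≋ b (suc l) i k       k≤b n       = begin
      restrictedSum b (suc l) i k n
        ≈⟨ SL.ΣL-tuples l b (λ rs → select k (sumℕ rs) (weightTerm i rs)) n ⟩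
      S.Σ< (suc b) column n
        ≈⟨ S.Σ<-truncate column (s≤s k≤b) (λ r k<r →
             SL.ΣL-zero (tuples l b) (λ rs → select-> k r (sumℕ rs) (weightTerm i (r ∷ rs)) k<r)) n ⟩
      S.Σ< (suc k) column n
        ≈⟨ S.Σ<-cong (suc k) {g = λ r → exponential i r ⊛ exponentialProduct l (suc i) (k ∸ r)}
             (λ r r<k → convolve r (ℕₚ.≤-pred r<k)) n ⟩
      S.Σ< (suc k) (λ r → exponential i r ⊛ exponentialProduct l (suc i) (k ∸ r)) n
        ≈⟨ P².⊛-Σ (exponential i) (exponentialProduct l (suc i)) k n ⟨
      exponentialProduct (suc l) i k n ∎
      where
      column : ℕ → Series
      column r = SL.ΣL (tuples l b) (λ rs → select k (r ℕ.+ sumℕ rs) (weightTerm i (r ∷ rs)))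
      convolve : ∀ r → r ≤ k → column r ≋ exponential i r ⊛ exponentialProduct l (suc i) (k ∸ r)
      convolve r r≤k n = begin
        column r n
          ≈⟨ SL.ΣL-cong (tuples l b) (λ rs → select-∷ k r (sumℕ rs) i rs r≤k) n ⟩
        SL.ΣL (tuples l b) (λ rs → exponential i r ⊛ select (k ∸ r) (sumℕ rs) (weightTerm (suc i) rs)) n
          ≈⟨ SL.ΣL-*ˡ (tuples l b) (exponential i r) (λ rs → select (k ∸ r) (sumℕ rs) (weightTerm (suc i) rs)) n ⟩
        (exponential i r ⊛ restrictedSum b l (suc i) (k ∸ r)) n
          ≈⟨ ⊛-cong {U = exponential i r} ≋.refl
               (restrictedSum≋ b l (suc i) (k ∸ r) (ℕₚ.≤-trans (ℕₚ.m∸n≤m k r) k≤b)) n ⟩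
        (exponential i r ⊛ exponentialProduct l (suc i) (k ∸ r)) n ∎

    partialSeries : ℕ → ℕ → Series
    partialSeries zero    i = 𝟘
    partialSeries (suc l) i = term i (f i) ⊕ partialSeries l (suc i)

    partialSeries-below : ∀ l i n → n < i → partialSeries l i n ≈ 0#
    partialSeries-below zero    i n n<i = refl
    partialSeries-below (suc l) i n n<i = trans
      (+-cong (term-off i (f i) n (ℕₚ.<⇒≢ n<i ∘ ≡.sym)) (partialSeries-below l (suc i) n (ℕₚ.m<n⇒m<1+n n<i)))
      (+-identityˡ 0#)

    partialSeries-within : ∀ l i n → i ≤ n → n < i ℕ.+ l → partialSeries l i n ≈ f n
    partialSeries-within zero i n i≤n n<i =
      contradiction i≤n (ℕₚ.<⇒≱ (≡.subst (n <_) (ℕₚ.+-identityʳ i) n<i))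
    partialSeries-within (suc l) i n i≤n n<i+l with i ℕₚ.≟ n
    ... | yes ≡.refl = trans (+-cong (term-at i (f i)) (partialSeries-below l (suc i) i ℕₚ.≤-refl)) (+-identityʳ _)
    ... | no i≢n     = trans
      (+-cong (term-off i (f i) n i≢n)
        (partialSeries-within l (suc i) n (ℕₚ.≤∧≢⇒< i≤n i≢n) (≡.subst (n <_) (ℕₚ.+-suc i l) n<i+l)))
      (+-identityˡ _)

    exponentialProduct-∂ : ∀ l i →
      P².∂ (exponentialProduct l i) P².≋ (partialSeries l i P².◂ exponentialProduct l i)
    exponentialProduct-∂ zero i k n = begin
      (suc k SMult.× 𝟘) n   ≈⟨ ·-coefficient (suc k) 𝟘 n ⟩
      suc k · 0#            ≈⟨ trans (·-ι (suc k) 0#) (zeroʳ _) ⟩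
      0#                    ≈⟨ ≋.zeroˡ (P².𝟙 k) n ⟨
      (𝟘 ⊛ P².𝟙 k) n        ∎
    exponentialProduct-∂ (suc l) i = P².≋.trans (P².∂-⊛ E G) (P².≋.trans
      (P².≋.+-cong
        (P².≋.trans (P².⊛-cong (exponential-∂ i) P².≋.refl) (P².◂-⊛ (term i (f i)) E G))
        (P².≋.trans (P².⊛-cong {U = E} P².≋.refl (exponentialProduct-∂ l (suc i))) (P².⊛-◂ (partialSeries l (suc i)) E G)))
      (λ k → ≋.sym (⊛-distribʳ ((E P².⊛ G) k) (term i (f i)) (partialSeries l (suc i)))))
      where
      E G : P².Series
      E = exponential i
      G = exponentialProduct l (suc i)

    exponentialProduct-0 : ∀ l i → exponentialProduct l i 0 ≋ 𝟙
    exponentialProduct-0 zero    i = ≋.refl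
    exponentialProduct-0 (suc l) i = ≋.trans
      (⊛-cong unit (exponentialProduct-0 l (suc i))) (⊛-identityˡ 𝟙)
      where
      unit : exponential i 0 ≋ 𝟙
      unit n = trans (reflexive (≡.cong (λ e → term e (1# * 1#) n) (ℕₚ.*-zeroʳ i))) (go n)
        where
        go : term 0 (1# * 1#) ≋ 𝟙
        go zero    = *-identityˡ 1#
        go (suc n) = refl

    -- The product of the exponentials is exp(u Y) with Y the partial sum of f, and Y^k / k! is read
    -- off from its differential equation in u. This takes the place of a multinomial expansion.
    exponentialProduct-coefficient : ∀ l i k → exponentialProduct l i k ≋ φ k ◂ (partialSeries l i Exp.^ k)
    exponentialProduct-coefficient l i zero    n = trans (exponentialProduct-0 l i n) (sym (*-identityˡ _))
    exponentialProduct-coefficient l i (suc k) n = ι-cancel k (begin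
      ι (suc k) * exponentialProduct l i (suc k) n            ≈⟨ ·-ι (suc k) _ ⟨
      suc k · exponentialProduct l i (suc k) n                ≈⟨ ·-coefficient (suc k) (exponentialProduct l i (suc k)) n ⟨
      (suc k SMult.× exponentialProduct l i (suc k)) n        ≈⟨ exponentialProduct-∂ l i k n ⟩
      (Y ⊛ exponentialProduct l i k) n
        ≈⟨ ⊛-cong {U = Y} ≋.refl (exponentialProduct-coefficient l i k) n ⟩
      (Y ⊛ (φ k ◂ (Y Exp.^ k))) n                             ≈⟨ ⊛-◂ (φ k) Y (Y Exp.^ k) n ⟩
      φ k * (Y Exp.^ suc k) n                                 ≈⟨ *-congʳ (φ-suc k) ⟨
      ι (suc k) * φ (suc k) * (Y Exp.^ suc k) n               ≈⟨ *-assoc _ _ _ ⟩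
      ι (suc k) * (φ (suc k) * (Y Exp.^ suc k) n)             ∎)
      where
      Y : Series
      Y = partialSeries l i

    bellFormula-coefficient : ∀ n k → k ≤ n → bellFormula n k x ≈ ι (n !) * (φ k * (f Exp.^ k) n)
    bellFormula-coefficient n k k≤n = begin
      bellFormula n k x
        ≈⟨ sumL-ΣL (tuples n n) _ ⟩
      ΣL (tuples n n) _
        ≈⟨ ΣL-cong (tuples n n) summand ⟩
      ΣL (tuples n n) (λ rs → ι (n !) * select k (sumℕ rs) (weightTerm 1 rs) n)
        ≈⟨ ΣL-*ˡ (tuples n n) (ι (n !)) _ ⟩
      ι (n !) * ΣL (tuples n n) (λ rs → select k (sumℕ rs) (weightTerm 1 rs) n)
        ≡⟨ ≡.cong (ι (n !) *_) (ΣL-coefficient (tuples n n) (λ rs → select k (sumℕ rs) (weightTerm 1 rs)) n) ⟨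
      ι (n !) * restrictedSum n n 1 k n
        ≈⟨ *-congˡ (restrictedSum≋ n n 1 k k≤n n) ⟩
      ι (n !) * exponentialProduct n 1 k n
        ≈⟨ *-congˡ (exponentialProduct-coefficient n 1 k n) ⟩
      ι (n !) * (φ k * (partialSeries n 1 Exp.^ k) n)
        -- Coefficient n of a power involves f only up to degree n, which is as far as n-tuples
        -- reach.
        ≈⟨ *-congˡ (*-congˡ (^-cong-≤ n k partial≈ n ℕₚ.≤-refl)) ⟩
      ι (n !) * (φ k * (f Exp.^ k) n) ∎
      where
      sumL-ΣL : ∀ (xs : List (List ℕ)) g → sumL (mapL g xs) ≈ ΣL xs g
      sumL-ΣL []       g = refl
      sumL-ΣL (y ∷ xs) g = +-congˡ (sumL-ΣL xs g)
      partial≈ : ∀ i → i ≤ n → partialSeries n 1 i ≈ f i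
      partial≈ zero    _   = partialSeries-below n 1 0 (s≤s z≤n)
      partial≈ (suc i) i<n = partialSeries-within n 1 (suc i) (s≤s z≤n) (s≤s i<n)
      summand : ∀ rs →
        (if ⌊ sumℕ rs ℕₚ.≟ k ⌋ ∧ ⌊ wsum 1 rs ℕₚ.≟ n ⌋ then divℕ (n !) (denom 1 rs) · monomial x 1 rs else 0#)
        ≈ ι (n !) * select k (sumℕ rs) (weightTerm 1 rs) n
      summand rs with sumℕ rs ℕₚ.≟ k
      ... | no _ = sym (zeroʳ _)
      ... | yes _ with wsum 1 rs ℕₚ.≟ n
      ...   | no w≢n = sym (trans (*-congˡ (term-off _ _ n w≢n)) (zeroʳ _))
      ...   | yes ≡.refl = begin
        d · monomial x 1 rs                        ≈⟨ ·-ι d _ ⟩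
        ι d * monomial x 1 rs                      ≈⟨ *-congˡ (weight-monomial 0 rs) ⟩
        ι d * (ι (denom 1 rs) * weight 1 rs)       ≈⟨ *-assoc _ _ _ ⟨
        ι d * ι (denom 1 rs) * weight 1 rs         ≈⟨ *-congʳ (×1-homo-* d (denom 1 rs)) ⟨
        ι (d ℕ.* denom 1 rs) * weight 1 rs
          ≈⟨ *-cong (reflexive (≡.cong ι (divℕ-exact _ (denom 1 rs) (denom∣wsum! 0 rs)))) (sym (term-at (wsum 1 rs) _)) ⟩
        ι (wsum 1 rs !) * weightTerm 1 rs (wsum 1 rs) ∎
        where
        d : ℕ
        d = divℕ (wsum 1 rs !) (denom 1 rs)

  Bell-coefficient : ∀ x n k → k ≤ n → Bell n k x ≈ ι (n !) * (φ k * (egf x Exp.^ k) n)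
  Bell-coefficient x zero    zero    _ = sym (trans (*-cong (+-identityʳ 1#) (*-identityˡ 1#)) (*-identityˡ 1#))
  Bell-coefficient x (suc n) zero    _ = sym (trans (*-congˡ (zeroʳ _)) (zeroʳ _))
  Bell-coefficient x (suc n) (suc k) k≤n = Expansion.bellFormula-coefficient x (suc n) (suc k) k≤n

-- Integrality of binomial coefficients with integer upper index.

fallingℤ-absorb : ∀ m j → fallingℤ (ℤ.suc m) (suc j) ≡ ℤ.suc m ℤ.* fallingℤ m j
fallingℤ-absorb m zero    = lemma m
  where
  lemma : ∀ m → + 1 ℤ.* (+ 1 ℤ.+ m ℤ.- + 0) ≡ (+ 1 ℤ.+ m) ℤ.* + 1
  lemma = ℤRing.solve-∀
fallingℤ-absorb m (suc j) =
  ≡.trans (≡.cong (ℤ._* (ℤ.suc m ℤ.- + suc j)) (fallingℤ-absorb m j)) (lemma m (fallingℤ m j) (+ j))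
  where
  lemma : ∀ m f j → (+ 1 ℤ.+ m) ℤ.* f ℤ.* (+ 1 ℤ.+ m ℤ.- (+ 1 ℤ.+ j)) ≡ (+ 1 ℤ.+ m) ℤ.* (f ℤ.* (m ℤ.- j))
  lemma = ℤRing.solve-∀

fallingℤ-pascal : ∀ m j → fallingℤ (ℤ.suc m) (suc j) ≡ fallingℤ m (suc j) ℤ.+ + suc j ℤ.* fallingℤ m j
fallingℤ-pascal m j = ≡.trans (fallingℤ-absorb m j) (lemma m (fallingℤ m j) (+ j))
  where
  lemma : ∀ m f j → (+ 1 ℤ.+ m) ℤ.* f ≡ f ℤ.* (m ℤ.- j) ℤ.+ (+ 1 ℤ.+ j) ℤ.* f
  lemma = ℤRing.solve-∀

FactorialsDivide : ℤ → Set
FactorialsDivide m = ∀ j → ∃ λ b → fallingℤ m j ≡ b ℤ.* + (j !)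

factorialsDivide-0 : FactorialsDivide (+ 0)
factorialsDivide-0 zero    = + 1 , ≡.refl
-- As 0 is the successor of -1, absorption exhibits the factor 0.
factorialsDivide-0 (suc j) = + 0 , ≡.trans (fallingℤ-absorb (ℤ.- + 1) j) (lemma (fallingℤ (ℤ.- + 1) j) (+ (suc j !)))
  where
  lemma : ∀ f d → + 0 ℤ.* f ≡ + 0 ℤ.* d
  lemma = ℤRing.solve-∀

factorialsDivide-suc : ∀ m → FactorialsDivide m → FactorialsDivide (ℤ.suc m)
factorialsDivide-suc m d zero    = + 1 , ≡.refl
factorialsDivide-suc m d (suc j) with d (suc j) | d j
... | b , e | b′ , e′ = b ℤ.+ b′ , (begin
  fallingℤ (ℤ.suc m) (suc j)                            ≡⟨ fallingℤ-pascal m j ⟩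
  fallingℤ m (suc j) ℤ.+ + suc j ℤ.* fallingℤ m j       ≡⟨ ≡.cong₂ (λ u v → u ℤ.+ + suc j ℤ.* v) e e′ ⟩
  b ℤ.* + (suc j !) ℤ.+ + suc j ℤ.* (b′ ℤ.* + (j !))
    ≡⟨ ≡.cong (λ u → b ℤ.* u ℤ.+ + suc j ℤ.* (b′ ℤ.* + (j !))) (ℤₚ.pos-* (suc j) (j !)) ⟩
  b ℤ.* (+ suc j ℤ.* + (j !)) ℤ.+ + suc j ℤ.* (b′ ℤ.* + (j !))  ≡⟨ lemma b b′ (+ suc j) (+ (j !)) ⟩
  (b ℤ.+ b′) ℤ.* (+ suc j ℤ.* + (j !))                  ≡⟨ ≡.cong ((b ℤ.+ b′) ℤ.*_) (ℤₚ.pos-* (suc j) (j !)) ⟨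
  (b ℤ.+ b′) ℤ.* + (suc j !)                            ∎)
  where
  open ≡.≡-Reasoning
  lemma : ∀ b b′ s f → b ℤ.* (s ℤ.* f) ℤ.+ s ℤ.* (b′ ℤ.* f) ≡ (b ℤ.+ b′) ℤ.* (s ℤ.* f)
  lemma = ℤRing.solve-∀

-- Pascal's rule read backwards. Its term of index j belongs to the unknown m as well, hence the
-- additional induction on j.
factorialsDivide-pred : ∀ m → FactorialsDivide (ℤ.suc m) → FactorialsDivide m
factorialsDivide-pred m d zero    = + 1 , ≡.refl
factorialsDivide-pred m d (suc j) with d (suc j) | factorialsDivide-pred m d j
... | b , e | b′ , e′ = b ℤ.- b′ , (begin
  fallingℤ m (suc j)                                    ≡⟨ move (fallingℤ m (suc j)) (+ suc j ℤ.* fallingℤ m j) ⟩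
  (fallingℤ m (suc j) ℤ.+ + suc j ℤ.* fallingℤ m j) ℤ.- + suc j ℤ.* fallingℤ m j
    ≡⟨ ≡.cong₂ (λ u v → u ℤ.- + suc j ℤ.* v) (≡.trans (≡.sym (fallingℤ-pascal m j)) e) e′ ⟩
  b ℤ.* + (suc j !) ℤ.- + suc j ℤ.* (b′ ℤ.* + (j !))
    ≡⟨ ≡.cong (λ u → b ℤ.* u ℤ.- + suc j ℤ.* (b′ ℤ.* + (j !))) (ℤₚ.pos-* (suc j) (j !)) ⟩
  b ℤ.* (+ suc j ℤ.* + (j !)) ℤ.- + suc j ℤ.* (b′ ℤ.* + (j !))  ≡⟨ lemma b b′ (+ suc j) (+ (j !)) ⟩
  (b ℤ.- b′) ℤ.* (+ suc j ℤ.* + (j !))                  ≡⟨ ≡.cong ((b ℤ.- b′) ℤ.*_) (ℤₚ.pos-* (suc j) (j !)) ⟨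
  (b ℤ.- b′) ℤ.* + (suc j !)                            ∎)
  where
  open ≡.≡-Reasoning
  move : ∀ u v → u ≡ (u ℤ.+ v) ℤ.- v
  move = ℤRing.solve-∀
  lemma : ∀ b b′ s f → b ℤ.* (s ℤ.* f) ℤ.- s ℤ.* (b′ ℤ.* f) ≡ (b ℤ.- b′) ℤ.* (s ℤ.* f)
  lemma = ℤRing.solve-∀

factorialsDivide : ∀ m → FactorialsDivide m
factorialsDivide (+ zero)     = factorialsDivide-0
factorialsDivide (+ suc n)    = factorialsDivide-suc (+ n) (factorialsDivide (+ n))
factorialsDivide -[1+ zero ]  = factorialsDivide-pred -[1+ 0 ] factorialsDivide-0
factorialsDivide -[1+ suc n ] = factorialsDivide-pred -[1+ suc n ] (factorialsDivide -[1+ n ])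

-- With q the computed quotient, the remainder is (b - q) d; being smaller than d, it forces |b - q|
-- < 1.
/ℕ-exact : ∀ b d .{{_ : ℕ.NonZero d}} → (b ℤ.* + d) ℤ./ℕ d ≡ b
/ℕ-exact b d = ≡.sym (ℤₚ.i-j≡0⇒i≡j b q (ℤₚ.∣i∣≡0⇒i≡0 (ℕₚ.n<1⇒n≡0 (ℕₚ.*-cancelʳ-< d _ 1 (≡.subst₂ _<_
  (≡.trans (≡.cong ℤ.∣_∣ remainder) (ℤₚ.abs-* (b ℤ.- q) (+ d))) (≡.sym (ℕₚ.*-identityˡ d))
  (ℤDivMod.n%ℕd<d (b ℤ.* + d) d))))))
  where
  q : ℤ
  q = (b ℤ.* + d) ℤ./ℕ d
  cancel : ∀ r q d → r ≡ (r ℤ.+ q ℤ.* d) ℤ.- q ℤ.* d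
  cancel = ℤRing.solve-∀
  factor : ∀ b q d → b ℤ.* d ℤ.- q ℤ.* d ≡ (b ℤ.- q) ℤ.* d
  factor = ℤRing.solve-∀
  remainder : + ((b ℤ.* + d) ℤ.%ℕ d) ≡ (b ℤ.- q) ℤ.* + d
  remainder = ≡.trans (cancel (+ ((b ℤ.* + d) ℤ.%ℕ d)) q (+ d)) (≡.trans
    (≡.cong (ℤ._- q ℤ.* + d) (≡.sym (ℤDivMod.a≡a%ℕn+[a/ℕn]*n (b ℤ.* + d) d))) (factor b q (+ d)))

binomℤ-exact : ∀ m j → binomℤ m j ℤ.* + (j !) ≡ fallingℤ m j
binomℤ-exact m j with factorialsDivide m j
... | b , e = ≡.trans
  (≡.cong (ℤ._* + (j !)) (≡.trans (≡.cong (λ u → (u ℤ./ℕ (j !)) {{j ℕₚ.!≢0}}) e) (/ℕ-exact b (j !) {{j ℕₚ.!≢0}})))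
  (≡.sym e)

-- From the binomial sums to interpolation.

module Evaluation {c ℓ} (F : CharZeroField c ℓ) where
  open CharZeroField F
  open FieldDefs F
  open Scalars F
  open Sums commRing
  open SetoidReasoning setoid
  open SemiringMult semiring using (×-homo-+; ×1-homo-*)
  open Exponentiation commutativeSemiring using (^-homo-*)
  open ℤ-Solver

  ι-split : ∀ {n} m k → n ≡ m ℕ.+ k → ι n ≈ ι m + ι k
  ι-split m k n≡ = trans (reflexive (≡.cong ι n≡)) (×-homo-+ 1# m k)

  ^-inverse : ∀ {a b} → a * b ≈ 1# → ∀ j → a ^ j * b ^ j ≈ 1#
  ^-inverse         e zero    = *-identityʳ 1#
  ^-inverse {a} {b} e (suc j) = begin
    (a * a ^ j) * (b * b ^ j)
      ≈⟨ solve 4 (λ a b c d → (a :* b) :* (c :* d) := (a :* c) :* (b :* d)) refl _ _ _ _ ⟩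
    (a * b) * (a ^ j * b ^ j)   ≈⟨ *-cong e (^-inverse e j) ⟩
    1# * 1#                     ≈⟨ *-identityʳ 1# ⟩
    1#                          ∎

  sumRange≈Σ< : ∀ a b f → sumRange a b f ≈ Σ< (suc b ∸ a) (λ t → f (a ℕ.+ t))
  sumRange≈Σ< a b f = trans (reflexive (≡.cong sumL (map-upTo (λ t → f (a ℕ.+ t)) (suc b ∸ a)))) (go (suc b ∸ a) _)
    where
    go : ∀ n g → sumL (applyUpTo g n) ≈ Σ< n g
    go zero    g = refl
    go (suc n) g = +-congˡ (go n (g ∘ suc))

  δ-≡ : ∀ n → δ n n ≈ 1#
  δ-≡ n with n ℕₚ.≟ n
  ... | yes _  = refl
  ... | no n≢n = contradiction ≡.refl n≢n

  δ-≢ : ∀ {n m} → n ≢ m → δ n m ≈ 0#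
  δ-≢ {n} {m} n≢m with n ℕₚ.≟ m
  ... | yes n≡m = contradiction n≡m n≢m
  ... | no _    = refl

  fromℤ-fallingℤ : ∀ m j → fromℤ (fallingℤ m j) ≈ fall (fromℤ m) j
  fromℤ-fallingℤ m zero    = +-identityʳ 1#
  fromℤ-fallingℤ m (suc j) = trans (fromℤ-* (fallingℤ m j) (m ℤ.- + j)) (*-cong (fromℤ-fallingℤ m j)
    (trans (fromℤ-+ m (ℤ.- + j)) (+-congˡ (fromℤ-neg (+ j)))))

  fromℤ-binomℤ : ∀ m j → fromℤ (binomℤ m j) ≈ β (fromℤ m) j
  fromℤ-binomℤ m j = begin
    B                                ≈⟨ *-identityʳ _ ⟨
    B * 1#                           ≈⟨ *-congˡ (!-φ j) ⟨
    B * (ι (j !) * φ j)              ≈⟨ *-assoc _ _ _ ⟨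
    B * ι (j !) * φ j                ≈⟨ *-congʳ (fromℤ-* (binomℤ m j) (+ (j !))) ⟨
    fromℤ (binomℤ m j ℤ.* + (j !)) * φ j  ≡⟨ ≡.cong (λ z → fromℤ z * φ j) (binomℤ-exact m j) ⟩
    fromℤ (fallingℤ m j) * φ j       ≈⟨ *-congʳ (fromℤ-fallingℤ m j) ⟩
    β (fromℤ m) j                    ∎
    where
    B : Carrier
    B = fromℤ (binomℤ m j)

  -- The rising factorial m (m+1) ... (m+k-1). It is the sign (-1)^k together with the factor common
  -- to all second binomials of the sum.
  ρ : ℕ → ℕ → Carrier
  ρ m k = (- 1#) ^ k * fall (- ι m) k

  -- For m ≥ 1 and n = m + k this amounts to `ρ m k` = (n-1)!/(m-1)!; the extra factors n and m keep
  -- it true at m = 0.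
  ρ-factorial : ∀ m k → ι (m !) * (ι (m ℕ.+ k) * ρ m k) ≈ ι ((m ℕ.+ k) !) * ι m
  ρ-factorial m zero    = begin
    ι (m !) * (ι (m ℕ.+ 0) * (1# * 1#))   ≈⟨ *-congˡ (trans (*-congˡ (*-identityʳ 1#)) (*-identityʳ _)) ⟩
    ι (m !) * ι (m ℕ.+ 0)                 ≡⟨ ≡.cong₂ (λ i j → ι (i !) * ι j) (≡.sym (ℕₚ.+-identityʳ m)) (ℕₚ.+-identityʳ m) ⟩
    ι ((m ℕ.+ 0) !) * ι m                 ∎
  ρ-factorial m (suc k) = begin
    ι (m !) * (ι (m ℕ.+ suc k) * ((- 1# * s) * (g * (- ι m - ι k))))
      ≡⟨ ≡.cong (λ i → ι (m !) * (ι i * ((- 1# * s) * (g * (- ι m - ι k))))) (ℕₚ.+-suc m k) ⟩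
    ι (m !) * (N * ((- 1# * s) * (g * (- ι m - ι k))))
      ≈⟨ solve 6 (λ a n s g m k → a :* (n :* ((con ℤ.-1ℤ :* s) :* (g :* (:- m :- k)))) :=
                                  n :* (a :* ((m :+ k) :* (s :* g)))) refl _ _ _ _ _ _ ⟩
    N * (ι (m !) * ((ι m + ι k) * (s * g)))      ≈⟨ *-congˡ (*-congˡ (*-congʳ (×-homo-+ 1# m k))) ⟨
    N * (ι (m !) * (ι (m ℕ.+ k) * ρ m k))        ≈⟨ *-congˡ (ρ-factorial m k) ⟩
    N * (ι ((m ℕ.+ k) !) * ι m)                  ≈⟨ *-assoc _ _ _ ⟨
    N * ι ((m ℕ.+ k) !) * ι m                    ≈⟨ *-congʳ (×1-homo-* (suc (m ℕ.+ k)) ((m ℕ.+ k) !)) ⟨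
    ι ((suc (m ℕ.+ k)) !) * ι m                  ≡⟨ ≡.cong (λ i → ι (i !) * ι m) (ℕₚ.+-suc m k) ⟨
    ι ((m ℕ.+ suc k) !) * ι m                    ∎
    where
    s g N : Carrier
    s = (- 1#) ^ k
    g = fall (- ι m) k
    N = ι (suc (m ℕ.+ k))

  ρ-φ : ∀ m k n → n ≡ m ℕ.+ k → ι n * ρ m k ≈ ι (n !) * (φ m * ι m)
  ρ-φ m k n ≡.refl = begin
    X                              ≈⟨ *-identityˡ X ⟨
    1# * X                         ≈⟨ *-congʳ (!-φ m) ⟨
    ι (m !) * φ m * X              ≈⟨ solve 3 (λ a b c → a :* b :* c := b :* (a :* c)) refl _ _ _ ⟩
    φ m * (ι (m !) * X)            ≈⟨ *-congˡ (ρ-factorial m k) ⟩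
    φ m * (ι (n !) * ι m)          ≈⟨ solve 3 (λ a b c → a :* (b :* c) := b :* (a :* c)) refl _ _ _ ⟩
    ι (n !) * (φ m * ι m)          ∎
    where
    X : Carrier
    X = ι n * ρ m k

  -- Serves both parts: (i) with g = p_k, (ii) with g = a^k r_k and the roles of a and h exchanged.
  -- In each summand (k+j)! cancels the denominator of the second binomial, a^(n+j) b^j collapses to
  -- a^n, and 1/j! completes a falling factorial of -n. The interpolation weights at y = -n remain.
  binomialSum : ∀ {a b} → a * b ≈ 1# → ∀ m k n → n ≡ m ℕ.+ k →
    ∀ {g} → Poly k g → (X : ℕ → Carrier) → (∀ j → X j ≈ ι ((k ℕ.+ j) !) * (φ j * (b ^ j * g (ι j)))) →
    (- 1#) ^ k * sumRange 0 k (λ j →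
      (fromℤ (binomℤ (+ (k ℕ.+ n)) (k ∸ j) ℤ.* binomℤ (+ k ℤ.- + n) (k ℕ.+ j)) * (a ^ (n ℕ.+ j))) * X j)
    ≈ ρ m k * (a ^ n * g (- ι n))
  binomialSum {a} {b} ab≈1 m k n n≡ {g} pg X X≈ = begin
    s * sumRange 0 k summand
      ≈⟨ *-congˡ (sumRange≈Σ< 0 k summand) ⟩
    s * Σ< (suc k) summand
      ≈⟨ *-congˡ (Σ<-cong (suc k) (λ j _ → rewriteSummand j)) ⟩
    s * Σ< (suc k) (λ j → C * (β (ι k - - ι n) (k ∸ j) * β (- ι n) j * g (ι j)))
      ≈⟨ *-congˡ (Σ<-*ˡ (suc k) C (λ j → β (ι k - - ι n) (k ∸ j) * β (- ι n) j * g (ι j))) ⟩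
    s * (C * Σ< (suc k) (λ j → β (ι k - - ι n) (k ∸ j) * β (- ι n) j * g (ι j)))
      ≈⟨ *-congˡ (*-congˡ (interpolation k pg (- ι n))) ⟩
    s * (fall (- ι m) k * a ^ n * g (- ι n))
      ≈⟨ solve 4 (λ a b c d → a :* (b :* c :* d) := (a :* b) :* (c :* d)) refl _ _ _ _ ⟩
    ρ m k * (a ^ n * g (- ι n)) ∎
    where
    s C : Carrier
    s = (- 1#) ^ k
    C = fall (- ι m) k * a ^ n

    summand : ℕ → Carrier
    summand j =
      (fromℤ (binomℤ (+ (k ℕ.+ n)) (k ∸ j) ℤ.* binomℤ (+ k ℤ.- + n) (k ℕ.+ j)) * (a ^ (n ℕ.+ j))) * X j

    upper : fromℤ (+ k ℤ.- + n) ≈ - ι m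
    upper = begin
      fromℤ (+ k ℤ.- + n)    ≈⟨ trans (fromℤ-+ (+ k) (ℤ.- + n)) (+-congˡ (fromℤ-neg (+ n))) ⟩
      ι k - ι n              ≈⟨ +-congˡ (-‿cong (ι-split m k n≡)) ⟩
      ι k - (ι m + ι k)      ≈⟨ solve 2 (λ m k → k :- (m :+ k) := :- m) refl _ _ ⟩
      - ι m                  ∎

    first : ∀ j → fromℤ (binomℤ (+ (k ℕ.+ n)) (k ∸ j)) ≈ β (ι k - - ι n) (k ∸ j)
    first j = trans (fromℤ-binomℤ (+ (k ℕ.+ n)) (k ∸ j)) (β-cong (k ∸ j)
      (trans (×-homo-+ 1# k n) (solve 2 (λ k n → k :+ n := k :- (:- n)) refl _ _)))

    -- Here k - n = -m. The falling factorial of length k + j is split after k factors, and its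
    -- second half starts at -m - k = -n; the first half is free of j.
    second : ∀ j → fromℤ (binomℤ (+ k ℤ.- + n) (k ℕ.+ j)) ≈ fall (- ι m) k * fall (- ι n) j * φ (k ℕ.+ j)
    second j = begin
      fromℤ (binomℤ (+ k ℤ.- + n) (k ℕ.+ j))               ≈⟨ fromℤ-binomℤ (+ k ℤ.- + n) (k ℕ.+ j) ⟩
      β (fromℤ (+ k ℤ.- + n)) (k ℕ.+ j)                    ≈⟨ β-cong (k ℕ.+ j) upper ⟩
      fall (- ι m) (k ℕ.+ j) * φ (k ℕ.+ j)                 ≈⟨ *-congʳ (fall-+ (- ι m) k j) ⟩
      fall (- ι m) k * fall (- ι m - ι k) j * φ (k ℕ.+ j)
        ≈⟨ *-congʳ (*-congˡ (fall-cong j (trans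
             (solve 2 (λ m k → :- m :- k := :- (m :+ k)) refl _ _) (-‿cong (sym (ι-split m k n≡)))))) ⟩
      fall (- ι m) k * fall (- ι n) j * φ (k ℕ.+ j)        ∎

    rewriteSummand : ∀ j → summand j ≈ C * (β (ι k - - ι n) (k ∸ j) * β (- ι n) j * g (ι j))
    rewriteSummand j = begin
      summand j
        ≈⟨ *-cong (*-cong (trans (fromℤ-* (binomℤ (+ (k ℕ.+ n)) (k ∸ j)) (binomℤ (+ k ℤ.- + n) (k ℕ.+ j)))
             (*-cong (first j) (second j))) (^-homo-* a n j)) (X≈ j) ⟩
      (B₁ * (fall (- ι m) k * fall (- ι n) j * φ (k ℕ.+ j)) * (a ^ n * a ^ j)) *
        (ι ((k ℕ.+ j) !) * (φ j * (b ^ j * g (ι j))))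
        ≈⟨ solve 10 (λ b₁ f₁ f₂ p an aj i q bj y →
             (b₁ :* (f₁ :* f₂ :* p) :* (an :* aj)) :* (i :* (q :* (bj :* y))) :=
             ((i :* p) :* (aj :* bj)) :* ((f₁ :* an) :* (b₁ :* (f₂ :* q) :* y)))
             refl _ _ _ _ _ _ _ _ _ _ ⟩
      ((ι ((k ℕ.+ j) !) * φ (k ℕ.+ j)) * (a ^ j * b ^ j)) * (C * (B₁ * β (- ι n) j * g (ι j)))
        ≈⟨ *-congʳ (trans (*-cong (!-φ (k ℕ.+ j)) (^-inverse ab≈1 j)) (*-identityʳ 1#)) ⟩
      1# * (C * (B₁ * β (- ι n) j * g (ι j)))
        ≈⟨ *-identityˡ _ ⟩
      C * (B₁ * β (- ι n) j * g (ι j)) ∎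
      where
      B₁ : Carrier
      B₁ = β (ι k - - ι n) (k ∸ j)

-- The companion family and the two identities.

module Orthogonality {c ℓ} (F : CharZeroField c ℓ) where
  open CharZeroField F
  open FieldDefs F
  open Scalars F
  open Sums commRing
  open PowerSeries commRing
  open Powers F
  open BellSeries F
  open Evaluation F
  open SetoidReasoning setoid
  open Exponentiation commutativeSemiring using (^-homo-*)
  open RingProperties ring using (+-cancelʳ)
  open ℤ-Solver
  private
    module Exp = Exponentiation ≋.commutativeSemiring

  term-⊛-at : ∀ j b U k → (term j b ⊛ U) (j ℕ.+ k) ≈ b * U k
  term-⊛-at zero    b U zero    = refl
  term-⊛-at zero    b U (suc k) =
    trans (+-congˡ (𝟘-⊛ (tail (term 0 b)) U (λ _ → refl) k)) (+-identityʳ _)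
  term-⊛-at (suc j) b U k       = trans (+-congʳ (zeroˡ _)) (trans (+-identityˡ _) (term-⊛-at j b U k))

  term-^ : ∀ b j → term 1 b Exp.^ j ≋ term j (b ^ j)
  term-^ b zero    zero    = refl
  term-^ b zero    (suc n) = refl
  term-^ b (suc j) = ≋.trans (⊛-cong {U = term 1 b} ≋.refl (term-^ b j)) (term-⊛ 1 j b (b ^ j))

  φ1≈1 : φ 1 ≈ 1#
  φ1≈1 = trans (sym (trans (*-congʳ (+-identityʳ 1#)) (*-identityˡ _))) (φ-suc 0)

  egf-cong : ∀ {x y} → (∀ i → x (suc i) ≈ y (suc i)) → egf x ≋ egf y
  egf-cong e zero    = refl
  egf-cong e (suc i) = *-congʳ (e i)

  Bell-1 : ∀ x i → Bell (suc i) 1 x ≈ x (suc i)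
  Bell-1 x i = begin
    Bell (suc i) 1 x                                             ≈⟨ Bell-coefficient x (suc i) 1 (s≤s z≤n) ⟩
    ι (suc i !) * (φ 1 * (egf x Exp.^ 1) (suc i))                ≈⟨ *-congˡ (*-cong φ1≈1 (≋.*-identityʳ (egf x) (suc i))) ⟩
    ι (suc i !) * (1# * (x (suc i) * φ (suc i)))
      ≈⟨ solve 3 (λ a b c → a :* (con (+ 1) :* (b :* c)) := a :* c :* b) refl _ _ _ ⟩
    ι (suc i !) * φ (suc i) * x (suc i)                          ≈⟨ trans (*-congʳ (!-φ (suc i))) (*-identityˡ _) ⟩
    x (suc i)                                                    ∎

  module Companion (Q Q⊥ : Family) (rep : BRepresentable Q) (isA : IsAEvaluatedAt (λ i → Q i 1) Q⊥) where
    x : ℕ → Carrier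
    x i = Q i 1

    h a : Carrier
    h = Q 1 1
    a = Q⊥ 1 1

    -- The companion is built on the first column of `Q`, not on the representing H. By `Bell-1` the
    -- two agree from index 1 on, and `egf` reads nothing else.
    Q≈Bell : ∀ n k → k ≤ n → Q n k ≈ Bell n k x
    Q≈Bell zero    zero    _   = proj₁ (proj₂ (proj₁ rep))
    Q≈Bell (suc n) zero    _   = proj₂ (proj₂ (proj₁ rep)) n
    Q≈Bell n       (suc k) k≤n = begin
      Q n (suc k)                                            ≈⟨ proj₂ (proj₂ rep) n (suc k) (s≤s z≤n) k≤n ⟩
      Bell n (suc k) H                                       ≈⟨ Bell-coefficient H n (suc k) k≤n ⟩
      ι (n !) * (φ (suc k) * (egf H Exp.^ suc k) n)          ≈⟨ *-congˡ (*-congˡ (Exp.^-congˡ (suc k) (egf-cong H≈x) n)) ⟩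
      ι (n !) * (φ (suc k) * (egf x Exp.^ suc k) n)          ≈⟨ Bell-coefficient x n (suc k) k≤n ⟨
      Bell n (suc k) x                                       ∎
      where
      H : ℕ → Carrier
      H = proj₁ (proj₂ rep)
      H≈x : ∀ i → H (suc i) ≈ x (suc i)
      H≈x i = trans (sym (Bell-1 H i)) (sym (proj₂ (proj₂ rep) (suc i) 1 (s≤s z≤n) (s≤s z≤n)))

    orthogonal : ∀ m K → Σ< (suc K) (λ t → Q⊥ (m ℕ.+ K) (m ℕ.+ t) * Q (m ℕ.+ t) m) ≈ δ (m ℕ.+ K) m
    orthogonal m K = begin
      Σ< (suc K) (λ t → Q⊥ n (m ℕ.+ t) * Q (m ℕ.+ t) m)
        ≈⟨ Σ<-cong (suc K) (λ t _ → *-congˡ {Q⊥ n (m ℕ.+ t)} (Q≈Bell (m ℕ.+ t) m (ℕₚ.m≤m+n m t))) ⟩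
      Σ< (suc K) (λ t → Q⊥ n (m ℕ.+ t) * Bell (m ℕ.+ t) m x)
        ≡⟨ ≡.cong (λ N → Σ< N (λ t → Q⊥ n (m ℕ.+ t) * Bell (m ℕ.+ t) m x))
             (≡.trans (≡.cong (_∸ m) (≡.sym (ℕₚ.+-suc m K))) (ℕₚ.m+n∸m≡n m (suc K))) ⟨
      Σ< (suc n ∸ m) (λ t → Q⊥ n (m ℕ.+ t) * Bell (m ℕ.+ t) m x)
        ≈⟨ sumRange≈Σ< m n (λ j → Q⊥ n j * Bell j m x) ⟨
      sumRange m n (λ j → Q⊥ n j * Bell j m x)
        ≈⟨ proj₂ isA n m (ℕₚ.m≤m+n m K) ⟩
      δ n m ∎
      where
      n : ℕ
      n = m ℕ.+ K

    -- Row 1 and column 1 of the orthogonality relation, a sum with one term: the companion itself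
    -- supplies the inverse of h.
    ah≈1 : a * h ≈ 1#
    ah≈1 = trans (sym (+-identityʳ _)) (orthogonal 1 0)

    -- f / t, scaled to the constant term 1 that the logarithmic derivative requires.
    G : Series
    G s = a * egf x (suc s)

    G₀ : G 0 ≈ 1#
    G₀ = trans (*-congˡ (trans (*-congˡ φ1≈1) (*-identityʳ h))) ah≈1

    open GeneralPower G G₀

    egf≋ : egf x ≋ term 1 h ⊛ G
    egf≋ zero    = sym (zeroˡ _)
    egf≋ (suc n) = sym (begin
      (term 1 h ⊛ G) (suc n)       ≈⟨ term-⊛-at 1 h G n ⟩
      h * (a * egf x (suc n))      ≈⟨ *-assoc _ _ _ ⟨
      h * a * egf x (suc n)        ≈⟨ *-congʳ (trans (*-comm h a) ah≈1) ⟩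
      1# * egf x (suc n)           ≈⟨ *-identityˡ _ ⟩
      egf x (suc n)                ∎)

    Q-power : ∀ k j → Q (k ℕ.+ j) j ≈ ι ((k ℕ.+ j) !) * (φ j * (h ^ j * p (ι j) k))
    Q-power k j = trans (Q≈Bell (k ℕ.+ j) j (ℕₚ.m≤n+m j k))
      (trans (Bell-coefficient x (k ℕ.+ j) j (ℕₚ.m≤n+m j k)) (*-congˡ (*-congˡ (begin
        (egf x Exp.^ j) (k ℕ.+ j)                      ≈⟨ Exp.^-congˡ j egf≋ (k ℕ.+ j) ⟩
        ((term 1 h ⊛ G) Exp.^ j) (k ℕ.+ j)             ≈⟨ Exp.^-distrib-* (term 1 h) G j (k ℕ.+ j) ⟩
        ((term 1 h Exp.^ j) ⊛ (G Exp.^ j)) (k ℕ.+ j)   ≈⟨ ⊛-cong (term-^ h j) (p-ι j) (k ℕ.+ j) ⟩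
        (term j (h ^ j) ⊛ p (ι j)) (k ℕ.+ j)           ≡⟨ ≡.cong (term j (h ^ j) ⊛ p (ι j)) (ℕₚ.+-comm k j) ⟩
        (term j (h ^ j) ⊛ p (ι j)) (j ℕ.+ k)           ≈⟨ term-⊛-at j (h ^ j) (p (ι j)) k ⟩
        h ^ j * p (ι j) k                              ∎))))

    inverseFamily : ℕ → ℕ → Carrier
    inverseFamily n j = ι (n !) * (φ j * (a ^ n * r (ι j) (n ∸ j)))

    -- The 1/j! of one factor cancels the j! of the other, and the powers of a and h do not depend
    -- on j. What is left is `lagrange`, or a single 1 if K = 0.
    inverseFamily-orthogonal : ∀ m K →
      Σ< (suc K) (λ t → inverseFamily (m ℕ.+ K) (m ℕ.+ t) * Q (m ℕ.+ t) m) ≈ δ (m ℕ.+ K) m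
    inverseFamily-orthogonal m K = begin
      Σ< (suc K) (λ t → inverseFamily n (m ℕ.+ t) * Q (m ℕ.+ t) m)
        ≈⟨ Σ<-cong (suc K) (λ t _ → summand t) ⟩
      Σ< (suc K) (λ t → C * (r (ι (m ℕ.+ t)) (K ∸ t) * p (ι m) t))
        ≈⟨ Σ<-*ˡ (suc K) C (λ t → r (ι (m ℕ.+ t)) (K ∸ t) * p (ι m) t) ⟩
      C * Σ< (suc K) (λ t → r (ι (m ℕ.+ t)) (K ∸ t) * p (ι m) t)
        ≈⟨ evaluate K ⟩
      δ n m ∎
      where
      n : ℕ
      n = m ℕ.+ K
      constant : ℕ → Carrier
      constant n = ι (n !) * φ m * (a ^ n * h ^ m)
      C : Carrier
      C = constant n
      summand : ∀ t → inverseFamily n (m ℕ.+ t) * Q (m ℕ.+ t) m ≈ C * (r (ι (m ℕ.+ t)) (K ∸ t) * p (ι m) t)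
      summand t = begin
        inverseFamily n j * Q j m
          ≈⟨ *-cong (reflexive (≡.cong (λ i → ι (n !) * (φ j * (a ^ n * r (ι j) i))) (ℕₚ.[m+n]∸[m+o]≡n∸o m K t)))
               (≡.subst (λ i → Q i m ≈ ι (i !) * (φ m * (h ^ m * p (ι m) t))) (ℕₚ.+-comm t m) (Q-power t m)) ⟩
        (ι (n !) * (φ j * (a ^ n * r (ι j) (K ∸ t)))) * (ι (j !) * (φ m * (h ^ m * p (ι m) t)))
          ≈⟨ solve 8 (λ n! φj an rj j! φm hm pm → (n! :* (φj :* (an :* rj))) :* (j! :* (φm :* (hm :* pm))) :=
                 (j! :* φj) :* (n! :* φm :* (an :* hm) :* (rj :* pm))) refl _ _ _ _ _ _ _ _ ⟩
        (ι (j !) * φ j) * (C * (r (ι j) (K ∸ t) * p (ι m) t))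
          ≈⟨ trans (*-congʳ (!-φ j)) (*-identityˡ _) ⟩
        C * (r (ι j) (K ∸ t) * p (ι m) t) ∎
        where
        j : ℕ
        j = m ℕ.+ t
      evaluate : ∀ K → constant (m ℕ.+ K) * Σ< (suc K) (λ t → r (ι (m ℕ.+ t)) (K ∸ t) * p (ι m) t) ≈ δ (m ℕ.+ K) m
      evaluate zero    = begin
        constant (m ℕ.+ 0) * (1# * 1# + 0#)
          ≡⟨ ≡.cong (λ i → constant i * (1# * 1# + 0#)) (ℕₚ.+-identityʳ m) ⟩
        ι (m !) * φ m * (a ^ m * h ^ m) * (1# * 1# + 0#)
          ≈⟨ *-congʳ (*-cong (!-φ m) (^-inverse ah≈1 m)) ⟩
        1# * 1# * (1# * 1# + 0#)
          ≈⟨ solve 0 (con (+ 1) :* con (+ 1) :* (con (+ 1) :* con (+ 1) :+ con (+ 0)) := con (+ 1)) refl ⟩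
        1#
          ≈⟨ trans (reflexive (≡.cong (λ i → δ i m) (ℕₚ.+-identityʳ m))) (δ-≡ m) ⟨
        δ (m ℕ.+ 0) m ∎
      evaluate (suc K) = trans (*-congˡ (lagrange m K)) (trans (zeroʳ _) (sym (δ-≢ (ℕₚ.m+1+n≢m m))))

    -- The diagonal entry is h^m, with inverse a^m.
    Q-diagonal-cancel : ∀ m {y z} → y * Q m m ≈ z * Q m m → y ≈ z
    Q-diagonal-cancel m {y} {z} e = begin
      y                   ≈⟨ lemma y ⟨
      y * Q m m * a ^ m   ≈⟨ *-congʳ e ⟩
      z * Q m m * a ^ m   ≈⟨ lemma z ⟩
      z                   ∎
      where
      lemma : ∀ y → y * Q m m * a ^ m ≈ y
      lemma y = begin
        y * Q m m * a ^ m
          ≈⟨ *-congʳ (*-congˡ (Q-power 0 m)) ⟩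
        y * (ι (m !) * (φ m * (h ^ m * 1#))) * a ^ m
          ≈⟨ solve 5 (λ y i p h a → y :* (i :* (p :* (h :* con (+ 1)))) :* a := y :* ((i :* p) :* (a :* h)))
               refl _ _ _ _ _ ⟩
        y * ((ι (m !) * φ m) * (a ^ m * h ^ m))
          ≈⟨ *-congˡ (trans (*-cong (!-φ m) (^-inverse ah≈1 m)) (*-identityʳ 1#)) ⟩
        y * 1#
          ≈⟨ *-identityʳ y ⟩
        y ∎

    -- Back substitution in row n, from column n downwards: the equation of column m adds the
    -- unknown of index m, with an invertible coefficient, to unknowns of larger index. The
    -- induction is on K = n - m.
    orthogonal-unique : ∀ n (X Y : ℕ → Carrier) →
      (∀ m K → m ℕ.+ K ≡ n →
        Σ< (suc K) (λ t → X (m ℕ.+ t) * Q (m ℕ.+ t) m) ≈ Σ< (suc K) (λ t → Y (m ℕ.+ t) * Q (m ℕ.+ t) m)) →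
      ∀ K m → m ℕ.+ K ≡ n → ∀ t → t ≤ K → X (m ℕ.+ t) ≈ Y (m ℕ.+ t)
    orthogonal-unique n X Y e K m m+K≡n t t≤K = go K m m+K≡n t t≤K
      where
      head : ∀ K m → m ℕ.+ K ≡ n → (∀ t → t < K → X (m ℕ.+ suc t) ≈ Y (m ℕ.+ suc t)) → X (m ℕ.+ 0) ≈ Y (m ℕ.+ 0)
      head K m m+K≡n tails = ≡.subst (λ i → X i ≈ Y i) (≡.sym (ℕₚ.+-identityʳ m)) (Q-diagonal-cancel m
        (≡.subst (λ i → X i * Q i m ≈ Y i * Q i m) (ℕₚ.+-identityʳ m)
          (+-cancelʳ (Σ< K (λ t → Y (m ℕ.+ suc t) * Q (m ℕ.+ suc t) m)) _ _
            (trans (+-congˡ (sym (Σ<-cong K (λ t t<K → *-congʳ {Q (m ℕ.+ suc t) m} (tails t t<K))))) (e m K m+K≡n)))))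
      go : ∀ K m → m ℕ.+ K ≡ n → ∀ t → t ≤ K → X (m ℕ.+ t) ≈ Y (m ℕ.+ t)
      below : ∀ K m → m ℕ.+ K ≡ n → ∀ t → t < K → X (m ℕ.+ suc t) ≈ Y (m ℕ.+ suc t)
      go K m m+K≡n zero    _   = head K m m+K≡n (below K m m+K≡n)
      go K m m+K≡n (suc t) t<K = below K m m+K≡n t t<K
      below (suc K) m m+K≡n t (s≤s t≤K) = ≡.subst (λ i → X i ≈ Y i) (≡.sym (ℕₚ.+-suc m t))
        (go K (suc m) (≡.trans (≡.sym (ℕₚ.+-suc m K)) m+K≡n) t t≤K)

    Q⊥≈inverseFamily : ∀ n j → j ≤ n → Q⊥ n j ≈ inverseFamily n j
    Q⊥≈inverseFamily n j j≤n = orthogonal-unique n (Q⊥ n) (inverseFamily n)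
      (λ { m K ≡.refl → trans (orthogonal m K) (sym (inverseFamily-orthogonal m K)) }) n 0 ≡.refl j j≤n

    Q⊥-power : ∀ k j → Q⊥ (k ℕ.+ j) j ≈ ι ((k ℕ.+ j) !) * (φ j * (a ^ (k ℕ.+ j) * r (ι j) k))
    Q⊥-power k j = trans (Q⊥≈inverseFamily (k ℕ.+ j) j (ℕₚ.m≤n+m j k))
      (reflexive (≡.cong (λ i → ι ((k ℕ.+ j) !) * (φ j * (a ^ (k ℕ.+ j) * r (ι j) i))) (ℕₚ.m+n∸n≡m k j)))

    -- `ρ-φ` evaluates `ρ` only together with a factor n. For k ≥ 1 this factor is found in p_k(-n),
    -- which is divisible by its argument; for k = 0 both sides are 1, as n = m.
    ρ-p : ∀ m k n → n ≡ m ℕ.+ k → ρ m k * p (- ι n) k ≈ ι (n !) * (φ m * r (ι m) k)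
    ρ-p m zero n n≡ = begin
      1# * 1# * 1#             ≈⟨ solve 0 (con (+ 1) :* con (+ 1) :* con (+ 1) := con (+ 1)) refl ⟩
      1#                       ≈⟨ !-φ m ⟨
      ι (m !) * φ m            ≡⟨ ≡.cong (λ i → ι (i !) * φ m) (≡.trans n≡ (ℕₚ.+-identityʳ m)) ⟨
      ι (n !) * φ m            ≈⟨ *-congˡ (*-identityʳ _) ⟨
      ι (n !) * (φ m * 1#)     ∎
    ρ-p m (suc k) n n≡ = begin
      ρ m (suc k) * p (- ι n) (suc k)                    ≈⟨ *-congˡ (p-suc (- ι n) k) ⟩
      ρ m (suc k) * (- ι n * S)
        ≈⟨ solve 3 (λ r n s → r :* (:- n :* s) := n :* r :* (con ℤ.-1ℤ :* s)) refl _ _ _ ⟩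
      ι n * ρ m (suc k) * (- 1# * S)                     ≈⟨ *-cong (ρ-φ m (suc k) n n≡) (*-congˡ (poly-cong k (σ-poly k)
        (trans (-‿cong (ι-split m (suc k) n≡)) (solve 2 (λ m k → :- (m :+ k) := :- k :- m) refl (ι m) (ι (suc k)))))) ⟩
      ι (n !) * (φ m * ι m) * (- 1# * S′)
        ≈⟨ solve 4 (λ a b c s → a :* (b :* c) :* (con ℤ.-1ℤ :* s) := a :* (b :* (con ℤ.-1ℤ :* (c :* s)))) refl _ _ _ _ ⟩
      ι (n !) * (φ m * (- 1# * (ι m * S′)))              ∎
      where
      S S′ : Carrier
      S  = σ (- ι n) k
      S′ = σ (- ι (suc k) - ι m) k

    -- The reflection of x to -k - x takes -n to m, so `r` at -n contains `σ` at m, and the factor m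
    -- that turns it into `p` comes from `ρ-φ`.
    ρ-r : ∀ m k n → n ≡ m ℕ.+ k → ρ m k * r (- ι n) k ≈ ι (n !) * (φ m * p (ι m) k)
    ρ-r m zero n n≡ = ρ-p m 0 n n≡
    ρ-r m (suc k) n n≡ = begin
      ρ m (suc k) * (- 1# * (- ι n * S))
        ≈⟨ solve 3 (λ r n s → r :* (con ℤ.-1ℤ :* (:- n :* s)) := n :* r :* s) refl _ _ _ ⟩
      ι n * ρ m (suc k) * S                     ≈⟨ *-cong (ρ-φ m (suc k) n n≡) (poly-cong k (σ-poly k) (begin
        - ι (suc k) - - ι n                       ≈⟨ +-congˡ (-‿cong (-‿cong (ι-split m (suc k) n≡))) ⟩
        - ι (suc k) - - (ι m + ι (suc k))         ≈⟨ solve 2 (λ m k → :- k :- (:- (m :+ k)) := m) refl (ι m) (ι (suc k)) ⟩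
        ι m                                       ∎)) ⟩
      ι (n !) * (φ m * ι m) * σ (ι m) k
        ≈⟨ solve 4 (λ a b c s → a :* (b :* c) :* s := a :* (b :* (c :* s))) refl _ _ _ _ ⟩
      ι (n !) * (φ m * (ι m * σ (ι m) k))       ≈⟨ *-congˡ (*-congˡ (p-suc (ι m) k)) ⟨
      ι (n !) * (φ m * p (ι m) (suc k))         ∎
      where
      S : Carrier
      S = σ (- ι (suc k) - - ι n) k

    partI : ∀ n k → k ≤ n →
      Q⊥ n (n ∸ k) ≈ ((- 1#) ^ k) * sumRange 0 k (λ j →
        (fromℤ (binomℤ (+ (k ℕ.+ n)) (k ∸ j) ℤ.* binomℤ (+ k ℤ.- + n) (k ℕ.+ j)) * (a ^ (n ℕ.+ j))) * Q (k ℕ.+ j) j)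
    partI n k k≤n = sym (begin
      _                                                  ≈⟨ binomialSum ah≈1 m k n n≡ (p-poly k) (λ j → Q (k ℕ.+ j) j) (Q-power k) ⟩
      ρ m k * (a ^ n * p (- ι n) k)
        ≈⟨ solve 3 (λ a b c → a :* (b :* c) := b :* (a :* c)) refl _ _ _ ⟩
      a ^ n * (ρ m k * p (- ι n) k)                      ≈⟨ *-congˡ (ρ-p m k n n≡) ⟩
      a ^ n * (ι (n !) * (φ m * r (ι m) k))
        ≈⟨ solve 4 (λ a b c d → a :* (b :* (c :* d)) := b :* (c :* (a :* d))) refl _ _ _ _ ⟩
      ι (n !) * (φ m * (a ^ n * r (ι m) k))              ≡⟨ ≡.cong (λ i → ι (n !) * (φ m * (a ^ n * r (ι m) i))) (ℕₚ.m∸[m∸n]≡n k≤n) ⟨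
      inverseFamily n m                                  ≈⟨ Q⊥≈inverseFamily n m (ℕₚ.m∸n≤m n k) ⟨
      Q⊥ n m                                             ∎)
      where
      m : ℕ
      m = n ∸ k
      n≡ : n ≡ m ℕ.+ k
      n≡ = ≡.sym (ℕₚ.m∸n+n≡m k≤n)

    partII : ∀ n k → k ≤ n →
      Q n (n ∸ k) ≈ ((- 1#) ^ k) * sumRange 0 k (λ j →
        (fromℤ (binomℤ (+ (k ℕ.+ n)) (k ∸ j) ℤ.* binomℤ (+ k ℤ.- + n) (k ℕ.+ j)) * (h ^ (n ℕ.+ j))) * Q⊥ (k ℕ.+ j) j)
    partII n k k≤n = sym (begin
      _
        -- The power a^(k+j) is split: a^j plays the part of b^j, and the constant a^k joins the
        -- polynomial, to be cancelled later by h^k out of h^n.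
        ≈⟨ binomialSum (trans (*-comm h a) ah≈1) m k n n≡ (poly-scale k (a ^ k) (r-poly k)) (λ j → Q⊥ (k ℕ.+ j) j)
             (λ j → trans (Q⊥-power k j) (*-congˡ (*-congˡ (trans (*-congʳ (^-homo-* a k j))
               (solve 3 (λ a b c → a :* b :* c := b :* (a :* c)) refl _ _ _))))) ⟩
      ρ m k * (h ^ n * (a ^ k * r (- ι n) k))
        ≡⟨ ≡.cong (λ i → ρ m k * (h ^ i * (a ^ k * r (- ι n) k))) n≡ ⟩
      ρ m k * (h ^ (m ℕ.+ k) * (a ^ k * r (- ι n) k))
        ≈⟨ *-congˡ (*-congʳ (^-homo-* h m k)) ⟩
      ρ m k * (h ^ m * h ^ k * (a ^ k * r (- ι n) k))
        ≈⟨ solve 5 (λ s b c d e → s :* (b :* c :* (d :* e)) := (d :* c) :* (b :* (s :* e))) refl _ _ _ _ _ ⟩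
      (a ^ k * h ^ k) * (h ^ m * (ρ m k * r (- ι n) k))
        ≈⟨ trans (*-congʳ (^-inverse ah≈1 k)) (*-identityˡ _) ⟩
      h ^ m * (ρ m k * r (- ι n) k)
        ≈⟨ *-congˡ (ρ-r m k n n≡) ⟩
      h ^ m * (ι (n !) * (φ m * p (ι m) k))
        ≈⟨ solve 4 (λ a b c d → a :* (b :* (c :* d)) := b :* (c :* (a :* d))) refl _ _ _ _ ⟩
      ι (n !) * (φ m * (h ^ m * p (ι m) k))
        ≈⟨ ≡.subst (λ i → Q i m ≈ ι (i !) * (φ m * (h ^ m * p (ι m) k))) (ℕₚ.m+[n∸m]≡n k≤n) (Q-power k m) ⟨
      Q n m ∎)
      where
      m : ℕ
      m = n ∸ k
      n≡ : n ≡ m ℕ.+ k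
      n≡ = ≡.sym (ℕₚ.m∸n+n≡m k≤n)

theorem5p7 : ∀ {c ℓ} (F : CharZeroField c ℓ) →
    let open CharZeroField F
        open FieldDefs F
    in (Q Q⊥ : Family) → BRepresentable Q → Regular Q →
       IsAEvaluatedAt (λ i → Q i 1) Q⊥ →
       ∀ n k → k ≤ n →
         (Q⊥ n (n ℕ.∸ k) ≈ ((- 1#) ^ k) * sumRange 0 k (λ j →
            (fromℤ (binomℤ (+ (k ℕ.+ n)) (k ℕ.∸ j) ℤ.* binomℤ (+ k ℤ.- + n) (k ℕ.+ j))
              * (Q⊥ 1 1 ^ (n ℕ.+ j))) * Q (k ℕ.+ j) j))
         × (Q n (n ℕ.∸ k) ≈ ((- 1#) ^ k) * sumRange 0 k (λ j →
            (fromℤ (binomℤ (+ (k ℕ.+ n)) (k ℕ.∸ j) ℤ.* binomℤ (+ k ℤ.- + n) (k ℕ.+ j))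
              * (Q 1 1 ^ (n ℕ.+ j))) * Q⊥ (k ℕ.+ j) j))
theorem5p7 F Q Q⊥ rep _ isA n k k≤n = partI n k k≤n , partII n k k≤n
  where open Orthogonality.Companion F Q Q⊥ rep isA
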